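{- Suppose $f$ is a pseudo-planar function over $\mathbb{F}_{2^n}$, identified with a function $f:T\to T$, and let $D_f=\{x+2\sqrt{f(x)}\mid x\in T\}\subseteq R=GR(4,n)$. Then the Fourier spectrum of $f$, i.e. the multiset $\{\chi(D_f)\mid\chi\in\widehat{R}\}$, is as follows. If $n$ is odd, put $b=2^{(n-1)/2}$. The values and their frequencies are: $2b^2$ with frequency $1$; $0$ with frequency $2b^2-1$; $b+b\mathbf{i}$ and $b-b\mathbf{i}$, each with frequency $\frac{b(2b^3+2b^2-b-1)}{2}$; $-b+b\mathbf{i}$ and $-b-b\mathbf{i}$, each with frequency $\frac{b(2b^3-2b^2-b+1)}{2}$. If $n$ is even, put $b=2^{(n-2)/2}$. The values and their frequencies are: $4b^2$ with frequency $1$; $0$ with frequency $4b^2-1$; $2b$ with frequency $b(4b^3+4b^2-b-1)$; $-2b$ with frequency $b(4b^3-4b^2-b+1)$; $2b\mathbf{i}$ and $-2b\mathbf{i}$, each with frequency $b^2(4b^2-1)$.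
   Context: $R=GR(4,n)$ is the Galois ring of characteristic $4$ with $4^n$ elements, and $Z=\{2x\mid x\in R\}$. The unit group $R\setminus Z$ contains a cyclic subgroup of order $2^n-1$ generated by some $\xi$; $T=\{\xi^i\mid 0\le i\le 2^n-2\}\cup\{0\}$ is the Teichmüller system. Each $x\in R$ is uniquely $x=a+2b$ with $a,b\in T$. Write $\sqrt{x}=x^{2^{n-1}}$. With $x\oplus y=x+y+2\sqrt{xy}$, $(T,\oplus,\cdot)$ is a field with $2^n$ elements, identified with $\mathbb{F}_{2^n}$. A function $f:T\to T$ is pseudo-planar if for each $\epsilon\in T\setminus\{0\}$ the map $x\mapsto f(x\oplus\epsilon)\oplus f(x)\oplus\epsilon x$ is a permutation of $T$. Trace: $\mathrm{Tr}:R\to\mathbb{Z}_4$, $\mathrm{Tr}(x)=\sum_{i=0}^{n-1}\sigma^i(x)$, where $\sigma(a+2b)=a^2+2b^2$ for $a,b\in T$. With $\mathbf{i}=\sqrt{ -1}$, the characters of $(R,+)$ are $\chi_a(x)=\mathbf{i}^{\mathrm{Tr}(ax)}$, $a\in R$, and $\widehat{R}=\{\chi_a\mid a\in R\}$. For $A\subseteq R$, $\chi(A)=\sum_{g\in A}\chi(g)$.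
   Formalization: The formal theorem adds the hypothesis f(0)=0; without it the claim is false (e.g. n=1, f≡1 gives values 2, 0, -1-i, -1+i), and it fails for every pseudo-planar f with f(0)≠0, since the frequencies force 0∈D_f. -}

module Defs where

open import Level using (Level) renaming (suc to lsuc)
open import Algebra.Bundles using (CommutativeRing; Semiring)
open import Algebra.Structures using (IsCommutativeRing)
import Algebra.Definitions.RawSemiring as RawSemiringDefs
open import Data.Nat.Base as ℕ using (ℕ; zero; suc; _∸_)
open import Data.Integer.Base as ℤ using (ℤ; +_; 0ℤ; 1ℤ)
import Data.Integer.Properties as ℤ
open import Data.Fin.Base using (Fin; toℕ)
import Data.Fin.Properties as Fin
open import Data.List.Base
  using (List; []; _++_; map; foldr; filter; find; deduplicate; replicate;
         allFin; upTo; cartesianProduct)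
open import Data.Maybe.Base using (maybe′)
open import Data.Product.Base using (_×_; _,_; ∃; ∃-syntax; proj₁; proj₂)
open import Data.Sum.Base using (_⊎_)
open import Function.Base using (_∘_)
open import Function.Bundles using (_↔_; _⇔_; Inverse)
open import Relation.Binary.Definitions using (DecidableEquality)
open import Relation.Binary.PropositionalEquality
  using (_≡_; _≢_; _≗_; refl; sym; trans; cong; subst)
open import Relation.Nullary.Decidable
  using (Dec; map′; _×-dec_; _⊎-dec_)
open import Relation.Unary using (Pred; Decidable)

-- The character values are sums of powers of i, so they lie in the subring
-- ℤ[i] of ℂ.

infix 5 _+i_

record ℤ[i] : Set where
  constructor _+i_
  field
    re im : ℤ

open ℤ[i] public

infix 4 _≟ᴳ_

_≟ᴳ_ : DecidableEquality ℤ[i]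
(a +i b) ≟ᴳ (c +i d) =
  map′ (λ { (refl , refl) → refl }) (λ { refl → refl , refl })
       ((a ℤ.≟ c) ×-dec (b ℤ.≟ d))

0ᴳ 1ᴳ 𝕚 : ℤ[i]
0ᴳ = 0ℤ +i 0ℤ
1ᴳ = 1ℤ +i 0ℤ
𝕚  = 0ℤ +i 1ℤ

infixl 6 _+ᴳ_
infixl 7 _*ᴳ_

_+ᴳ_ _*ᴳ_ : ℤ[i] → ℤ[i] → ℤ[i]
(a +i b) +ᴳ (c +i d) = (a ℤ.+ c) +i (b ℤ.+ d)
(a +i b) *ᴳ (c +i d) = (a ℤ.* c ℤ.- b ℤ.* d) +i (a ℤ.* d ℤ.+ b ℤ.* c)

_^ᴳ_ : ℤ[i] → ℕ → ℤ[i]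
z ^ᴳ zero  = 1ᴳ
z ^ᴳ suc k = z *ᴳ (z ^ᴳ k)

-- A Galois ring is a finite commutative ring whose zero divisors, together
-- with 0, form the ideal (p · 1) for a prime p.  Characteristic 4 and
-- cardinality 4ⁿ then determine it up to isomorphism.  Since 2 ≢ 0, such a
-- ring exists only for n ≥ 1.

record GaloisRing₄ (c : Level) (n : ℕ) : Set (lsuc c) where
  infixl 6 _+_
  infixl 7 _*_
  infix  8 -_
  field
    Carrier           : Set c
    _+_ _*_           : Carrier → Carrier → Carrier
    -_                : Carrier → Carrier
    0# 1#             : Carrier
    isCommutativeRing : IsCommutativeRing _≡_ _+_ _*_ -_ 0# 1#

  2# : Carrier
  2# = 1# + 1#

  field
    enumeration   : Carrier ↔ Fin (4 ℕ.^ n)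
    2≢0           : 2# ≢ 0#
    4≡0           : 2# + 2# ≡ 0#
    zeroDivisors  : ∀ x → (∃[ y ] (y ≢ 0# × x * y ≡ 0#)) ⇔ (∃[ y ] x ≡ 2# * y)

  commutativeRing : CommutativeRing c c
  commutativeRing = record { isCommutativeRing = isCommutativeRing }

  open RawSemiringDefs (Semiring.rawSemiring (CommutativeRing.semiring commutativeRing)) public
    using (_^_) renaming (_×_ to _·_)

  private module E = Inverse enumeration

  elements : List Carrier
  elements = map E.from (allFin (4 ℕ.^ n))

  from-to : ∀ x → E.from (E.to x) ≡ x
  from-to x = E.inverseʳ refl

  infix 4 _≟_

  _≟_ : DecidableEquality Carrier
  x ≟ y = map′ (λ eq → trans (sym (from-to x)) (trans (cong E.from eq) (from-to y)))
               (cong E.to) (E.to x Fin.≟ E.to y)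

  any? : ∀ {p} {P : Pred Carrier p} → Decidable P → Dec (∃ P)
  any? {P = P} P? =
    map′ (λ (i , p) → E.from i , p)
         (λ (x , p) → E.to x , subst P (sym (from-to x)) p)
         (Fin.any? (P? ∘ E.from))

  all? : ∀ {p} {P : Pred Carrier p} → Decidable P → Dec (∀ x → P x)
  all? {P = P} P? =
    map′ (λ p x → subst P (from-to x) (p (E.to x)))
         (λ p i → p (E.from i))
         (Fin.all? (P? ∘ E.from))

  HasOrder : Carrier → ℕ → Set c
  HasOrder x m = x ^ m ≡ 1# × (∀ k → 0 ℕ.< k → k ℕ.< m → x ^ k ≢ 1#)

module Teichmüller {c n} (G : GaloisRing₄ c n) (ξ : GaloisRing₄.Carrier G) where
  open GaloisRing₄ G

  T : Pred Carrier c
  T x = (∃[ i ] x ≡ ξ ^ toℕ {2 ℕ.^ n ∸ 1} i) ⊎ x ≡ 0#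

  T? : Decidable T
  T? x = Fin.any? (λ i → x ≟ ξ ^ toℕ i) ⊎-dec (x ≟ 0#)

  √_ : Carrier → Carrier
  √ x = x ^ (2 ℕ.^ (n ∸ 1))

  infixl 6 _⊕_

  _⊕_ : Carrier → Carrier → Carrier
  x ⊕ y = x + y + 2# * √ (x * y)

  -- A function T → T is represented by a function on R that maps T into T;
  -- its values outside T are irrelevant.

  MapsT : (Carrier → Carrier) → Set c
  MapsT g = ∀ {x} → T x → T (g x)

  PermutesT : (Carrier → Carrier) → Set c
  PermutesT g = MapsT g
              × (∀ {x y} → T x → T y → g x ≡ g y → x ≡ y)
              × (∀ {y} → T y → ∃[ x ] (T x × g x ≡ y))

  PseudoPlanar : (Carrier → Carrier) → Set c
  PseudoPlanar f = MapsT f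
                 × (∀ ε → T ε → ε ≢ 0# → PermutesT (λ x → f (x ⊕ ε) ⊕ f x ⊕ ε * x))

  D : (Carrier → Carrier) → Pred Carrier c
  D f g = ∃[ x ] (T x × g ≡ x + 2# * √ (f x))

  D? : ∀ f → Decidable (D f)
  D? f g = any? (λ x → T? x ×-dec (g ≟ x + 2# * √ (f x)))

  -- σ (a + 2b) = a² + 2b² for a, b ∈ T.  Every x has exactly one such
  -- decomposition, so the search succeeds and the value 0# is never used.

  σ : Carrier → Carrier
  σ x = maybe′ (λ (a , b) → a ^ 2 + 2# * b ^ 2) 0#
          (find (λ (a , b) → x ≟ a + 2# * b) (cartesianProduct Ts Ts))
    where
    Ts : List Carrier
    Ts = filter T? elements

  σ^ : ℕ → Carrier → Carrier
  σ^ zero    x = x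
  σ^ (suc i) x = σ (σ^ i x)

  -- The trace as an element of R; it lies in the prime subring {0, 1, 2, 3} ≅ ℤ₄.

  trace : Carrier → Carrier
  trace x = foldr _+_ 0# (map (λ i → σ^ i x) (upTo n))

  -- The k ∈ {0, 1, 2, 3} with trace x ≡ k · 1; again the search succeeds.

  Tr : Carrier → ℕ
  Tr x = maybe′ (λ k → k) 0 (find (λ k → trace x ≟ k · 1#) (upTo 4))

  χ : Carrier → Carrier → ℤ[i]
  χ a x = 𝕚 ^ᴳ Tr (a * x)

  -- The set {χ a ∣ a ∈ R}: each function on R is listed once.

  R̂ : List (Carrier → ℤ[i])
  R̂ = deduplicate (λ φ ψ → all? (λ x → φ x ≟ᴳ ψ x)) (map χ elements)

  ∑ : (Carrier → ℤ[i]) → {A : Pred Carrier c} → Decidable A → ℤ[i]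
  ∑ φ A? = foldr _+ᴳ_ 0ᴳ (map φ (filter A? elements))

  -- Lists up to permutation _↭_ serve as finite multisets.

  fourierSpectrum : (Carrier → Carrier) → List ℤ[i]
  fourierSpectrum f = map (λ φ → ∑ φ (D? f)) R̂

-- In the frequencies below, positive terms are written before negative ones;
-- for b ≥ 1 no truncated subtraction goes below zero, and the divisions by 2
-- are exact.

oddSpectrum : ℕ → List ℤ[i]
oddSpectrum b =
     replicate 1                                              (+ (2 * b ^ 2) +i 0ℤ)
  ++ replicate (2 * b ^ 2 ∸ 1)                                (0ℤ +i 0ℤ)
  ++ replicate (b * (2 * b ^ 3 + 2 * b ^ 2 ∸ b ∸ 1) / 2)      (+ b +i + b)
  ++ replicate (b * (2 * b ^ 3 + 2 * b ^ 2 ∸ b ∸ 1) / 2)      (+ b +i ℤ.- + b)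
  ++ replicate (b * (2 * b ^ 3 + 1 ∸ 2 * b ^ 2 ∸ b) / 2)      (ℤ.- + b +i + b)
  ++ replicate (b * (2 * b ^ 3 + 1 ∸ 2 * b ^ 2 ∸ b) / 2)      (ℤ.- + b +i ℤ.- + b)
  where
  open import Data.Nat.Base using (_+_; _*_; _^_; _/_)

evenSpectrum : ℕ → List ℤ[i]
evenSpectrum b =
     replicate 1                                              (+ (4 * b ^ 2) +i 0ℤ)
  ++ replicate (4 * b ^ 2 ∸ 1)                                (0ℤ +i 0ℤ)
  ++ replicate (b * (4 * b ^ 3 + 4 * b ^ 2 ∸ b ∸ 1))          (+ (2 * b) +i 0ℤ)
  ++ replicate (b * (4 * b ^ 3 + 1 ∸ 4 * b ^ 2 ∸ b))          (ℤ.- + (2 * b) +i 0ℤ)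
  ++ replicate (b ^ 2 * (4 * b ^ 2 ∸ 1))                      (0ℤ +i + (2 * b))
  ++ replicate (b ^ 2 * (4 * b ^ 2 ∸ 1))                      (0ℤ +i ℤ.- + (2 * b))
  where
  open import Data.Nat.Base using (_+_; _*_; _^_)

{-# OPTIONS --safe #-}

-- Let q = 2ⁿ and D = { d t ∣ t ∈ T } with d t = t + 2 √(f t).  For a ∉ 2R the substitution s = t ⊕ ε in
-- χ_a(D) · conj χ_a(D) = ∑_{s,t} χ_a(d s - d t) leaves, for every ε ≠ 0, a multiple of the sum of χ_a over
-- 2R, because f is pseudo-planar; this sum vanishes, so |χ_a(D)|² = q.  For a ∈ 2R, χ_a(D) is itself such
-- a sum: it is q for a = 0 and 0 otherwise.  An element of ℤ[i] whose norm is the power q of 2 can take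
-- only four values, and their frequencies are then determined by ∑_a χ_a(D) = ∑_a χ_a(D)² = q², which
-- holds because d s + d t = 0 only for s = t = 0.  That the χ_a are pairwise distinct characters comes down
-- to the trace being nonzero modulo 2, which follows by expanding ∑_j ξ^(-j) Tr(ξ^j) into geometric sums.

module Submission where

open import Defs
open import Level using (Level; 0ℓ)
open import Algebra.Bundles using (RawRing; CommutativeRing)
open import Algebra.Core using (Op₂)
import Algebra.Properties.CommutativeSemiring.Exp as CommutativeSemiringExp
import Algebra.Properties.Monoid.Mult as MonoidMult
import Algebra.Properties.Semiring.Exp as SemiringExp
import Algebra.Properties.Semiring.Mult as SemiringMult
import Algebra.Properties.Semiring.Mult.TCOptimised as TCOptimised
import Algebra.Solver.Ring as RingSolver
open import Algebra.Solver.Ring.AlmostCommutativeRing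
  using (_-Raw-AlmostCommutative⟶_; fromCommutativeRing)
open import Algebra.Structures using (IsCommutativeRing)
open import Data.Empty using (⊥; ⊥-elim)
open import Data.Fin.Base using (Fin; toℕ)
import Data.Fin.Base as Fin
import Data.Fin.Properties as Fin
open import Data.Integer.Base as ℤ using (ℤ; 0ℤ; 1ℤ)
import Data.Integer.Properties as ℤ
import Data.Integer.Tactic.RingSolver as ℤ-Solver
open import Data.List.Base
  using (List; []; _∷_; _++_; map; foldr; filter; find; deduplicate; length; replicate;
         cartesianProduct; applyUpTo; upTo; allFin; tabulate)
open import Data.List.Properties
  using (map-++; map-∘; map-cong; map-tabulate; map-upTo; filter-all;
         length-++; length-map; length-replicate; length-tabulate)
open import Data.List.Membership.Propositional using (_∈_)
open import Data.List.Membership.Propositional.Properties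
  using (∈-map⁻; ∈-map⁺; ∈-∃++; ∈-allFin; ∈-filter⁺; ∈-filter⁻; ∈-applyUpTo⁻;
         ∈-cartesianProduct⁺; ∈-cartesianProduct⁻)
open import Data.List.Membership.Propositional.Properties.WithK using (unique∧set⇒bag)
open import Data.List.Relation.Binary.BagAndSetEquality using (∼bag⇒↭)
open import Data.List.Relation.Binary.Permutation.Propositional
  using (_↭_; ↭-sym; ↭-trans; ↭-refl; ↭-prep; ↭-reflexive)
import Data.List.Relation.Binary.Permutation.Propositional as Perm
open import Data.List.Relation.Binary.Permutation.Propositional.Properties
  using (shift; ↭-length; ∈-resp-↭; map⁺; ++⁺ˡ)
open import Data.List.Relation.Unary.All as All using (All)
open import Data.List.Relation.Unary.AllPairs as AllPairs using (AllPairs; []; _∷_)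
import Data.List.Relation.Unary.AllPairs.Properties as AllPairs
open import Data.List.Relation.Unary.Any using (here; there)
open import Data.List.Relation.Unary.Unique.Propositional using (Unique)
import Data.List.Relation.Unary.Unique.Propositional.Properties as Unique
open import Data.Maybe.Base using (Maybe; just; nothing; maybe′)
open import Data.Nat.Base as ℕ using (ℕ; zero; suc; _∸_; z≤n; s≤s; NonZero)
import Data.Nat.DivMod as ℕ
import Data.Nat.Properties as ℕ
import Data.Nat.Tactic.RingSolver as ℕ-Solver
open import Data.Product.Base using (_×_; _,_; ∃; ∃-syntax; proj₁; proj₂)
  renaming (map to map×)
open import Data.Product.Properties using (×-≡,≡→≡)
open import Data.Sum.Base using (_⊎_; inj₁; inj₂; reduce)
import Data.Vec.Base as Vec
open import Data.Vec.N-ary using (N-ary; Eq; curryⁿ; curryⁿ-cong; _$ⁿ_)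
open import Function.Base using (_∘_; id)
open import Function.Bundles using (Inverse; Equivalence; mk⇔)
open import Relation.Binary.Core using (Rel)
import Relation.Binary.Definitions as Binary
open import Relation.Binary.Definitions using (tri<; tri≈; tri>)
open import Relation.Binary.PropositionalEquality
  using (_≡_; _≢_; refl; sym; trans; cong; cong₂; subst; isEquivalence; module ≡-Reasoning)
open import Relation.Nullary using (¬_; yes; no)
open import Relation.Nullary.Decidable using (_×-dec_; ¬?; decidable-stable)
open import Relation.Unary using (Decidable; Pred)

-- The second moment is taken without conjugation because the sum of the norms would only repeat
-- that each norm is q. Over the units four frequencies are unknown; their total, both components of
-- the first moment and one component of the second (imaginary for odd n, real for even n, the other
-- one being trivial) give four independent real equations. Replacing `f` by `f ⊕ c` multiplies
-- χ_a(D) by the sign χ_a(2 √c). This changes neither norms nor squares, so it is the first moment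
-- that feels `f 0# ≡ 0#`: the assumption puts 0 into D and thereby fixes the balance of the signs.
--
-- The residue field R / 2R is never formed. Squaring turns a congruence modulo 2 into an equality,
-- because 4 = 0; hence x^q depends only on the class of x and serves as its Teichmüller
-- representative. That each class has one follows by counting: the q² values a + 2b with a, b ∈ T
-- are distinct, and R has q² elements.

private variable
  ℓa ℓb ℓp ℓr : Level
  A : Set ℓa
  B : Set ℓb

-- Lists without repetition

∉⇒All≢ : ∀ {x : A} {xs} → (∀ {y} → y ∈ xs → x ≢ y) → All (x ≢_) xs
∉⇒All≢ = All.tabulate

unique-map : ∀ (h : A → B) {xs} → (∀ {x y} → x ∈ xs → y ∈ xs → h x ≡ h y → x ≡ y) →
             Unique xs → Unique (map h xs)
unique-map h inj []             = []
unique-map h {x ∷ xs} inj (x≢ ∷ xs!) =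
  ∉⇒All≢ (λ y∈ eq → let z , z∈ , y≡ = ∈-map⁻ h y∈ in
            All.lookup x≢ z∈ (inj (here refl) (there z∈) (trans eq y≡)))
  ∷ unique-map h (λ u v → inj (there u) (there v)) xs!

-- Pigeonhole without decidable equality: each element of `xs` is cut out of `ys`, and equal lengths
-- leave nothing over. Surjectivity of injective maps between finite lists comes from here.
unique-⊆-↭ : ∀ {xs ys : List A} → Unique xs → (∀ {x} → x ∈ xs → x ∈ ys) →
             length xs ≡ length ys → xs ↭ ys
unique-⊆-↭ {ys = []}    []         sub eq = ↭-refl
unique-⊆-↭ {xs = x ∷ xs} (x≢ ∷ xs!) sub eq
  with us , vs , refl ← ∈-∃++ (sub (here refl)) =
  ↭-trans (↭-prep x (unique-⊆-↭ xs! sub′ len)) (↭-sym (shift x us vs))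
  where
  sub′ : ∀ {z} → z ∈ xs → z ∈ us ++ vs
  sub′ z∈ with ∈-resp-↭ (shift x us vs) (sub (there z∈))
  ... | here z≡x = ⊥-elim (All.lookup x≢ z∈ (sym z≡x))
  ... | there z∈′ = z∈′
  len = ℕ.suc-injective (trans eq (↭-length (shift x us vs)))

injective⇒map-↭ : ∀ (h : A → A) {xs} → Unique xs → (∀ {x} → x ∈ xs → h x ∈ xs) →
                  (∀ {x y} → x ∈ xs → y ∈ xs → h x ≡ h y → x ≡ y) → map h xs ↭ xs
injective⇒map-↭ h {xs} xs! into inj =
  unique-⊆-↭ (unique-map h inj xs!)
    (λ y∈ → let x , x∈ , y≡ = ∈-map⁻ h y∈ in subst (_∈ xs) (sym y≡) (into x∈))
    (length-map h xs)

unique-≋-↭ : ∀ {xs ys : List A} → Unique xs → Unique ys → (∀ {x} → x ∈ xs → x ∈ ys) →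
             (∀ {x} → x ∈ ys → x ∈ xs) → xs ↭ ys
unique-≋-↭ xs! ys! to from = ∼bag⇒↭ (unique∧set⇒bag xs! ys! (mk⇔ to from))

length-cartesianProduct : ∀ (xs : List A) (ys : List B) →
                          length (cartesianProduct xs ys) ≡ length xs ℕ.* length ys
length-cartesianProduct []       ys = refl
length-cartesianProduct (x ∷ xs) ys = trans (length-++ (map (x ,_) ys))
  (cong₂ ℕ._+_ (length-map (x ,_) ys) (length-cartesianProduct xs ys))

-- Meant for the list of characters: they are pairwise distinct, so `R̂` is indexed by the elements
-- of R.
deduplicate-distinct : ∀ {R : Rel A ℓr} (R? : Binary.Decidable R) {xs} →
                       AllPairs (λ x y → ¬ R x y) xs → deduplicate R? xs ≡ xs
deduplicate-distinct R? []                  = refl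
deduplicate-distinct R? {x ∷ xs} (x≁ ∷ xs!) rewrite deduplicate-distinct R? xs! =
  cong (x ∷_) (filter-all (¬? ∘ R? x) x≁)

-- `σ` and `Tr` are searches with a default value. A witness `w` excludes the default, but the
-- search may stop earlier at some other `v`, about which only `P v` is known.
find-just : ∀ {P : Pred A ℓp} (P? : Decidable P) {xs w} → w ∈ xs → P w →
            ∃ λ v → find P? xs ≡ just v × v ∈ xs × P v
find-just P? {x ∷ xs} w∈ Pw with P? x
... | yes Px = x , refl , here refl , Px
find-just P? {x ∷ xs} (here refl) Pw | no ¬Px = ⊥-elim (¬Px Pw)
find-just P? {x ∷ xs} (there w∈)  Pw | no ¬Px =
  let v , eq , v∈ , Pv = find-just P? w∈ Pw in v , eq , there v∈ , Pv

map-allFin : ∀ (g : ℕ → A) n → map (g ∘ toℕ) (allFin n) ≡ applyUpTo g n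
map-allFin g n = trans (map-tabulate id (g ∘ toℕ)) (tabulate-toℕ g n)
  where
  tabulate-toℕ : ∀ (g : ℕ → A) n → tabulate {n = n} (g ∘ toℕ) ≡ applyUpTo g n
  tabulate-toℕ g zero    = refl
  tabulate-toℕ g (suc n) = cong (g 0 ∷_) (tabulate-toℕ (g ∘ suc) n)

-- Sums over lists

module ListSum {a} {A : Set a} {_+_ _*_ : Op₂ A} { -_ : A → A} {0# 1# : A}
               (isCommutativeRing : IsCommutativeRing _≡_ _+_ _*_ -_ 0# 1#) where

  open IsCommutativeRing isCommutativeRing
    using (+-assoc; +-comm; +-identityˡ; +-identityʳ; distribˡ; zeroʳ; *-comm)
  open ≡-Reasoning

  ∑[_] : ∀ {b} {B : Set b} → List B → (B → A) → A
  ∑[ xs ] f = foldr _+_ 0# (map f xs)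

  module _ {b} {B : Set b} where

    ∑-cong : ∀ {f g : B → A} xs → (∀ {x} → x ∈ xs → f x ≡ g x) → ∑[ xs ] f ≡ ∑[ xs ] g
    ∑-cong []       eq = refl
    ∑-cong (x ∷ xs) eq = cong₂ _+_ (eq (here refl)) (∑-cong xs (eq ∘ there))

    interchange : ∀ w x y z → (w + x) + (y + z) ≡ (w + y) + (x + z)
    interchange w x y z = begin
      (w + x) + (y + z) ≡⟨ +-assoc w x (y + z) ⟩
      w + (x + (y + z)) ≡⟨ cong (w +_) (+-assoc x y z) ⟨
      w + ((x + y) + z) ≡⟨ cong (λ v → w + (v + z)) (+-comm x y) ⟩
      w + ((y + x) + z) ≡⟨ cong (w +_) (+-assoc y x z) ⟩
      w + (y + (x + z)) ≡⟨ +-assoc w y (x + z) ⟨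
      (w + y) + (x + z) ∎

    ∑-distrib-+ : ∀ (f g : B → A) xs → ∑[ xs ] (λ x → f x + g x) ≡ ∑[ xs ] f + ∑[ xs ] g
    ∑-distrib-+ f g []       = sym (+-identityˡ 0#)
    ∑-distrib-+ f g (x ∷ xs) =
      trans (cong ((f x + g x) +_) (∑-distrib-+ f g xs)) (interchange _ _ _ _)

    ∑-distrib-* : ∀ c (f : B → A) xs → ∑[ xs ] (λ x → c * f x) ≡ c * ∑[ xs ] f
    ∑-distrib-* c f []       = sym (zeroʳ c)
    ∑-distrib-* c f (x ∷ xs) =
      trans (cong ((c * f x) +_) (∑-distrib-* c f xs)) (sym (distribˡ c _ _))

    ∑-distrib-*ʳ : ∀ c (f : B → A) xs → ∑[ xs ] (λ x → f x * c) ≡ ∑[ xs ] f * c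
    ∑-distrib-*ʳ c f xs = trans (∑-cong xs (λ {x} _ → *-comm (f x) c)) (trans (∑-distrib-* c f xs) (*-comm c _))

    ∑-zero : ∀ (f : B → A) xs → (∀ {x} → x ∈ xs → f x ≡ 0#) → ∑[ xs ] f ≡ 0#
    ∑-zero f []       eq = refl
    ∑-zero f (x ∷ xs) eq =
      trans (cong₂ _+_ (eq (here refl)) (∑-zero f xs (eq ∘ there))) (+-identityˡ 0#)

    ∑-++ : ∀ (f : B → A) xs ys → ∑[ xs ++ ys ] f ≡ ∑[ xs ] f + ∑[ ys ] f
    ∑-++ f []       ys = sym (+-identityˡ _)
    ∑-++ f (x ∷ xs) ys = trans (cong (f x +_) (∑-++ f xs ys)) (sym (+-assoc _ _ _))

    ∑-map : ∀ {c} {C : Set c} (f : C → A) (h : B → C) xs → ∑[ map h xs ] f ≡ ∑[ xs ] (f ∘ h)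
    ∑-map f h []       = refl
    ∑-map f h (x ∷ xs) = cong (f (h x) +_) (∑-map f h xs)

    ∑-↭ : ∀ (f : B → A) {xs ys} → xs ↭ ys → ∑[ xs ] f ≡ ∑[ ys ] f
    ∑-↭ f Perm.refl         = refl
    ∑-↭ f (Perm.prep x p)   = cong (f x +_) (∑-↭ f p)
    ∑-↭ f (Perm.swap {ys = ys} x y p) rewrite ∑-↭ f p =
      trans (sym (+-assoc (f x) (f y) _))
            (trans (cong (_+ ∑[ ys ] f) (+-comm (f x) (f y))) (+-assoc (f y) (f x) _))
    ∑-↭ f (Perm.trans p q)  = trans (∑-↭ f p) (∑-↭ f q)

  ∑-swap : ∀ {b c} {B : Set b} {C : Set c} (f : B → C → A) xs ys →
           ∑[ xs ] (λ x → ∑[ ys ] (f x)) ≡ ∑[ ys ] (λ y → ∑[ xs ] (λ x → f x y))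
  ∑-swap f []       ys = sym (∑-zero _ ys (λ _ → refl))
  ∑-swap f (x ∷ xs) ys =
    trans (cong (∑[ ys ] (f x) +_) (∑-swap f xs ys)) (sym (∑-distrib-+ _ _ ys))

  ∑-* : ∀ {b c} {B : Set b} {C : Set c} (f : B → A) (g : C → A) xs ys →
        ∑[ xs ] f * ∑[ ys ] g ≡ ∑[ xs ] (λ x → ∑[ ys ] (λ y → f x * g y))
  ∑-* f g xs ys = trans (sym (∑-distrib-*ʳ (∑[ ys ] g) f xs))
    (∑-cong xs (λ {x} _ → sym (∑-distrib-* (f x) g ys)))

  -- Both sides are g 0 + ... + g n. When g n = g 0 the shifted sum equals the original one, which
  -- gives the invariance of the trace under `σ` and of a geometric sum under its ratio.
  applyUpTo-shift : ∀ (g : ℕ → A) n → foldr _+_ 0# (applyUpTo (g ∘ suc) n) + g 0 ≡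
                                      foldr _+_ 0# (applyUpTo g n) + g n
  applyUpTo-shift g zero    = refl
  applyUpTo-shift g (suc n) = begin
    (g 1 + s₂) + g 0   ≡⟨ cong (_+ g 0) (+-comm (g 1) s₂) ⟩
    (s₂ + g 1) + g 0   ≡⟨ cong (_+ g 0) (applyUpTo-shift (g ∘ suc) n) ⟩
    (s₁ + g (suc n)) + g 0 ≡⟨ +-comm _ (g 0) ⟩
    g 0 + (s₁ + g (suc n)) ≡⟨ +-assoc (g 0) s₁ (g (suc n)) ⟨
    (g 0 + s₁) + g (suc n) ∎
    where
    s₁ s₂ : A
    s₁ = foldr _+_ 0# (applyUpTo (g ∘ suc) n)
    s₂ = foldr _+_ 0# (applyUpTo (g ∘ suc ∘ suc) n)

-- Gaussian integers

-ᴳ_ : ℤ[i] → ℤ[i]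
-ᴳ (a +i b) = (ℤ.- a) +i (ℤ.- b)

conj : ℤ[i] → ℤ[i]
conj (a +i b) = a +i (ℤ.- b)

*ᴳ-assoc : ∀ x y z → (x *ᴳ y) *ᴳ z ≡ x *ᴳ (y *ᴳ z)
*ᴳ-assoc (a +i b) (c +i d) (e +i f) = cong₂ _+i_ (r a b c d e f) (i a b c d e f)
  where
  open import Data.Integer.Base
  r : ∀ a b c d e f → (a * c - b * d) * e - (a * d + b * c) * f ≡
                      a * (c * e - d * f) - b * (c * f + d * e)
  r = ℤ-Solver.solve-∀
  i : ∀ a b c d e f → (a * c - b * d) * f ℤ.+ (a * d + b * c) * e ≡
                      a * (c * f + d * e) + b * (c * e - d * f)
  i = ℤ-Solver.solve-∀

*ᴳ-comm : ∀ x y → x *ᴳ y ≡ y *ᴳ x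
*ᴳ-comm (a +i b) (c +i d) = cong₂ _+i_ (r a b c d) (i a b c d)
  where
  open import Data.Integer.Base
  r : ∀ a b c d → a * c - b * d ≡ c * a - d * b
  r = ℤ-Solver.solve-∀
  i : ∀ a b c d → a * d + b * c ≡ c * b + d * a
  i = ℤ-Solver.solve-∀

*ᴳ-identityˡ : ∀ x → 1ᴳ *ᴳ x ≡ x
*ᴳ-identityˡ (a +i b) = cong₂ _+i_ (r a b) (i a b)
  where
  open import Data.Integer.Base
  r : ∀ a b → 1ℤ * a - 0ℤ * b ≡ a
  r = ℤ-Solver.solve-∀
  i : ∀ a b → 1ℤ * b + 0ℤ * a ≡ b
  i = ℤ-Solver.solve-∀

*ᴳ-identityʳ : ∀ x → x *ᴳ 1ᴳ ≡ x
*ᴳ-identityʳ x = trans (*ᴳ-comm x 1ᴳ) (*ᴳ-identityˡ x)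

*ᴳ-distribˡ : ∀ x y z → x *ᴳ (y +ᴳ z) ≡ x *ᴳ y +ᴳ x *ᴳ z
*ᴳ-distribˡ (a +i b) (c +i d) (e +i f) = cong₂ _+i_ (r a b c d e f) (i a b c d e f)
  where
  open import Data.Integer.Base
  r : ∀ a b c d e f → a * (c + e) - b * (d + f) ≡ (a * c - b * d) ℤ.+ (a * e - b * f)
  r = ℤ-Solver.solve-∀
  i : ∀ a b c d e f → a * (d + f) + b * (c + e) ≡ (a * d + b * c) ℤ.+ (a * f + b * e)
  i = ℤ-Solver.solve-∀

*ᴳ-distribʳ : ∀ x y z → (y +ᴳ z) *ᴳ x ≡ y *ᴳ x +ᴳ z *ᴳ x
*ᴳ-distribʳ x y z = trans (*ᴳ-comm (y +ᴳ z) x)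
  (trans (*ᴳ-distribˡ x y z) (cong₂ _+ᴳ_ (*ᴳ-comm x y) (*ᴳ-comm x z)))

isCommutativeRingᴳ : IsCommutativeRing _≡_ _+ᴳ_ _*ᴳ_ -ᴳ_ 0ᴳ 1ᴳ
isCommutativeRingᴳ = record
  { isRing = record
    { +-isAbelianGroup = record
      { isGroup = record
        { isMonoid = record
          { isSemigroup = record
            { isMagma = record { isEquivalence = isEquivalence ; ∙-cong = cong₂ _+ᴳ_ }
            ; assoc = λ (a +i b) (c +i d) (e +i f) → cong₂ _+i_ (ℤ.+-assoc a c e) (ℤ.+-assoc b d f)
            }
          ; identity = (λ (a +i b) → cong₂ _+i_ (ℤ.+-identityˡ a) (ℤ.+-identityˡ b))
                     , (λ (a +i b) → cong₂ _+i_ (ℤ.+-identityʳ a) (ℤ.+-identityʳ b))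
          }
        ; inverse = (λ (a +i b) → cong₂ _+i_ (ℤ.+-inverseˡ a) (ℤ.+-inverseˡ b))
                  , (λ (a +i b) → cong₂ _+i_ (ℤ.+-inverseʳ a) (ℤ.+-inverseʳ b))
        ; ⁻¹-cong = cong -ᴳ_
        }
      ; comm = λ (a +i b) (c +i d) → cong₂ _+i_ (ℤ.+-comm a c) (ℤ.+-comm b d)
      }
    ; *-cong = cong₂ _*ᴳ_
    ; *-assoc = *ᴳ-assoc
    ; *-identity = *ᴳ-identityˡ , *ᴳ-identityʳ
    ; distrib = *ᴳ-distribˡ , *ᴳ-distribʳ
    }
  ; *-comm = *ᴳ-comm
  }

open IsCommutativeRing isCommutativeRingᴳ
  using () renaming (zeroʳ to *ᴳ-zeroʳ; +-identityˡ to +ᴳ-identityˡ; +-identityʳ to +ᴳ-identityʳ)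

open ListSum isCommutativeRingᴳ
  using () renaming (∑[_] to ∑ᴳ[_])
module ∑ᴳ = ListSum isCommutativeRingᴳ

^ᴳ-homo-+ : ∀ z k l → z ^ᴳ (k ℕ.+ l) ≡ (z ^ᴳ k) *ᴳ (z ^ᴳ l)
^ᴳ-homo-+ z zero    l = sym (*ᴳ-identityˡ _)
^ᴳ-homo-+ z (suc k) l = trans (cong (z *ᴳ_) (^ᴳ-homo-+ z k l)) (sym (*ᴳ-assoc z _ _))

conj-+ : ∀ x y → conj (x +ᴳ y) ≡ conj x +ᴳ conj y
conj-+ (a +i b) (c +i d) = cong ((a ℤ.+ c) +i_) (ℤ.neg-distrib-+ b d)

conj-∑ : ∀ {b} {B : Set b} (f : B → ℤ[i]) xs → conj (∑ᴳ[ xs ] f) ≡ ∑ᴳ[ xs ] (λ x → conj (f x))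
conj-∑ f []       = refl
conj-∑ f (x ∷ xs) = trans (conj-+ (f x) _) (cong (conj (f x) +ᴳ_) (conj-∑ f xs))

normᴳ : ℤ[i] → ℤ
normᴳ (a +i b) = a ℤ.* a ℤ.+ b ℤ.* b

*ᴳ-conj : ∀ z → z *ᴳ conj z ≡ normᴳ z +i 0ℤ
*ᴳ-conj (a +i b) = cong₂ _+i_ (r a b) (i a b)
  where
  open import Data.Integer.Base
  r : ∀ a b → a * a - b * - b ≡ a * a + b * b
  r = ℤ-Solver.solve-∀
  i : ∀ a b → a * - b + b * a ≡ 0ℤ
  i = ℤ-Solver.solve-∀

𝕚^4+ : ∀ k → 𝕚 ^ᴳ (4 ℕ.+ k) ≡ 𝕚 ^ᴳ k
𝕚^4+ k = trans (^ᴳ-homo-+ 𝕚 4 k) (*ᴳ-identityˡ (𝕚 ^ᴳ k))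

*ᴳ-conj-𝕚^ : ∀ k → (𝕚 ^ᴳ k) *ᴳ conj (𝕚 ^ᴳ k) ≡ 1ᴳ
*ᴳ-conj-𝕚^ 0 = refl
*ᴳ-conj-𝕚^ 1 = refl
*ᴳ-conj-𝕚^ 2 = refl
*ᴳ-conj-𝕚^ 3 = refl
*ᴳ-conj-𝕚^ (suc (suc (suc (suc k)))) = trans (cong (λ z → z *ᴳ conj z) (𝕚^4+ k)) (*ᴳ-conj-𝕚^ k)

square≡∣∣² : ∀ x → x ℤ.* x ≡ ℤ.+ (ℤ.∣ x ∣ ℕ.* ℤ.∣ x ∣)
square≡∣∣² (ℤ.+ m)      = sym (ℤ.pos-* m m)
square≡∣∣² ℤ.-[1+ m ] = refl

normᴳ≡∣∣² : ∀ a b → normᴳ (a +i b) ≡ ℤ.+ (ℤ.∣ a ∣ ℕ.* ℤ.∣ a ∣ ℕ.+ ℤ.∣ b ∣ ℕ.* ℤ.∣ b ∣)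
normᴳ≡∣∣² a b = trans (cong₂ ℤ._+_ (square≡∣∣² a) (square≡∣∣² b))
                      (sym (ℤ.pos-+ (ℤ.∣ a ∣ ℕ.* ℤ.∣ a ∣) (ℤ.∣ b ∣ ℕ.* ℤ.∣ b ∣)))

normᴳ≡0⇒≡0ᴳ : ∀ z → normᴳ z ≡ 0ℤ → z ≡ 0ᴳ
normᴳ≡0⇒≡0ᴳ (a +i b) eq = cong₂ _+i_ (vanish a (ℕ.m+n≡0⇒m≡0 _ sum≡0)) (vanish b (ℕ.m+n≡0⇒n≡0 _ sum≡0))
  where
  sum≡0 : ℤ.∣ a ∣ ℕ.* ℤ.∣ a ∣ ℕ.+ ℤ.∣ b ∣ ℕ.* ℤ.∣ b ∣ ≡ 0
  sum≡0 = ℤ.+-injective (trans (sym (normᴳ≡∣∣² a b)) eq)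
  vanish : ∀ x → ℤ.∣ x ∣ ℕ.* ℤ.∣ x ∣ ≡ 0 → x ≡ 0ℤ
  vanish x eq = ℤ.∣i∣≡0⇒i≡0 (reduce (ℕ.m*n≡0⇒m≡0∨n≡0 ℤ.∣ x ∣ eq))

-- From (c - 1) z = 0, multiplication by the conjugate of c - 1 makes the nonzero integer norm of c
-- - 1 annihilate both coordinates of z, so that cancellation in ℤ suffices.
*ᴳ-fixed⇒≡0ᴳ : ∀ c z → c ≢ 1ᴳ → c *ᴳ z ≡ z → z ≡ 0ᴳ
*ᴳ-fixed⇒≡0ᴳ c@(u +i v) z@(x +i y) c≢1 eq with cong re eq | cong im eq
... | eqr | eqi = cong₂ _+i_ (kill x kx) (kill y ky)
  where
  open import Data.Integer.Base
  N : ℤ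
  N = normᴳ ((u - 1ℤ) +i v)
  N≢0 : N ≢ 0ℤ
  N≢0 N≡0 with normᴳ≡0⇒≡0ᴳ ((u - 1ℤ) +i v) N≡0
  ... | w≡0 = c≢1 (cong₂ _+i_ (ℤ.i-j≡0⇒i≡j u 1ℤ (cong re w≡0)) (cong im w≡0))
  kill : ∀ t → N * t ≡ 0ℤ → t ≡ 0ℤ
  kill t Nt≡0 with ℤ.i*j≡0⇒i≡0∨j≡0 N Nt≡0
  ... | inj₁ N≡0 = ⊥-elim (N≢0 N≡0)
  ... | inj₂ t≡0 = t≡0
  rx : ∀ u v x y → ((u - 1ℤ) * (u - 1ℤ) + v * v) * x ≡
       (u - 1ℤ) * ((u * x - v * y) - x) + v * ((u * y + v * x) - y)
  rx = ℤ-Solver.solve-∀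
  ry : ∀ u v x y → ((u - 1ℤ) * (u - 1ℤ) + v * v) * y ≡
       (u - 1ℤ) * ((u * y + v * x) - y) - v * ((u * x - v * y) - x)
  ry = ℤ-Solver.solve-∀
  e₁ : (u * x - v * y) - x ≡ 0ℤ
  e₁ = ℤ.i≡j⇒i-j≡0 eqr
  e₂ : (u * y + v * x) - y ≡ 0ℤ
  e₂ = ℤ.i≡j⇒i-j≡0 eqi
  kx : N * x ≡ 0ℤ
  kx = trans (rx u v x y) (cong₂ _+_ (trans (cong ((u - 1ℤ) *_) e₁) (ℤ.*-zeroʳ (u - 1ℤ))) (trans (cong (v *_) e₂) (ℤ.*-zeroʳ v)))
  ky : N * y ≡ 0ℤ
  ky = trans (ry u v x y) (cong₂ _-_ (trans (cong ((u - 1ℤ) *_) e₂) (ℤ.*-zeroʳ (u - 1ℤ))) (trans (cong (v *_) e₁) (ℤ.*-zeroʳ v)))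

-- Permuting the summands by `h` leaves the sum unchanged and also multiplies it by c. With `h` a
-- translation this yields both orthogonality relations, `∑-T-0` and `∑-R-0`.
∑ᴳ-semiinvariant≡0 : ∀ {b} {B : Set b} (φ : B → ℤ[i]) (h : B → B) (c : ℤ[i]) {xs} → map h xs ↭ xs →
                     (∀ {x} → x ∈ xs → φ (h x) ≡ c *ᴳ φ x) → c ≢ 1ᴳ → ∑ᴳ[ xs ] φ ≡ 0ᴳ
∑ᴳ-semiinvariant≡0 φ h c {xs} perm eq c≢1 = *ᴳ-fixed⇒≡0ᴳ c (∑ᴳ[ xs ] φ) c≢1 (begin
  c *ᴳ ∑ᴳ[ xs ] φ               ≡⟨ ∑ᴳ.∑-distrib-* c φ xs ⟨
  ∑ᴳ[ xs ] (λ x → c *ᴳ φ x)     ≡⟨ ∑ᴳ.∑-cong xs eq ⟨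
  ∑ᴳ[ xs ] (λ x → φ (h x))      ≡⟨ ∑ᴳ.∑-map φ h xs ⟨
  ∑ᴳ[ map h xs ] φ              ≡⟨ ∑ᴳ.∑-↭ φ perm ⟩
  ∑ᴳ[ xs ] φ                    ∎)
  where open ≡-Reasoning

∑ᴳ-const-1 : ∀ {b} {B : Set b} (xs : List B) → ∑ᴳ[ xs ] (λ _ → 1ᴳ) ≡ ℤ.+ length xs +i 0ℤ
∑ᴳ-const-1 []       = refl
∑ᴳ-const-1 (_ ∷ xs) = cong (1ᴳ +ᴳ_) (∑ᴳ-const-1 xs)

-- The Galois ring

module Galois {c : Level} (n′ : ℕ) (G : GaloisRing₄ c (suc n′)) (ξ : GaloisRing₄.Carrier G)
              (ξ-order : GaloisRing₄.HasOrder G ξ (2 ℕ.^ suc n′ ∸ 1)) where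

  open GaloisRing₄ G
  open Teichmüller G ξ
  open IsCommutativeRing isCommutativeRing
    using (+-assoc; +-comm; +-identityˡ; +-identityʳ; *-assoc; *-comm; *-identityˡ; *-identityʳ;
           distribˡ; distribʳ; zeroˡ; zeroʳ; -‿inverseˡ; -‿inverseʳ)
  open ≡-Reasoning

  private
    semiring = CommutativeRing.semiring commutativeRing
    commutativeSemiring = CommutativeRing.commutativeSemiring commutativeRing

  open SemiringExp semiring using (^-homo-*; ^-assocʳ)
  open SemiringMult semiring using (×1-homo-*)
  open MonoidMult (CommutativeRing.+-monoid commutativeRing) using (×-homo-+)
  open TCOptimised semiring using (×ᵤ≈×)
    renaming (_×_ to _×′_; ×-homo-+ to ×′-homo-+; ×1-homo-* to ×′1-homo-*)
  open CommutativeSemiringExp commutativeSemiring using (^-distrib-*)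

  -- A ring solver that knows 4 = 0: its coefficients are reduced modulo 4.

  mod4 : ℕ → ℕ
  mod4 (suc (suc (suc (suc k)))) = mod4 k
  mod4 k                         = k

  4·1+ : ∀ y → 1# + (1# + (1# + (1# + y))) ≡ y
  4·1+ y = begin
    1# + (1# + (1# + (1# + y))) ≡⟨ +-assoc 1# 1# _ ⟨
    2# + (1# + (1# + y))        ≡⟨ cong (2# +_) (+-assoc 1# 1# y) ⟨
    2# + (2# + y)               ≡⟨ +-assoc 2# 2# y ⟨
    2# + 2# + y                 ≡⟨ cong (_+ y) 4≡0 ⟩
    0# + y                      ≡⟨ +-identityˡ y ⟩
    y                           ∎

  mod4-· : ∀ k → mod4 k · 1# ≡ k · 1#
  mod4-· 0 = refl
  mod4-· 1 = refl
  mod4-· 2 = refl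
  mod4-· 3 = refl
  mod4-· (suc (suc (suc (suc k)))) = trans (mod4-· k) (sym (4·1+ (k · 1#)))

  mod4-×′ : ∀ k → mod4 k ×′ 1# ≡ k ×′ 1#
  mod4-×′ k = trans (sym (×ᵤ≈× (mod4 k) 1#)) (trans (mod4-· k) (×ᵤ≈× k 1#))

  ℤ₄ : RawRing 0ℓ 0ℓ
  ℤ₄ = record
    { Carrier = ℕ ; _≈_ = _≡_
    ; _+_ = λ k l → mod4 (k ℕ.+ l) ; _*_ = λ k l → mod4 (k ℕ.* l) ; -_ = λ k → mod4 (3 ℕ.* k)
    ; 0# = 0 ; 1# = 1 }

  ℤ₄-neg : ∀ k → mod4 (3 ℕ.* k) ×′ 1# ≡ - (k ×′ 1#)
  ℤ₄-neg k = begin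
    mod4 (3 ℕ.* k) ×′ 1#                        ≡⟨ +-identityʳ _ ⟨
    mod4 (3 ℕ.* k) ×′ 1# + 0#                   ≡⟨ cong₂ _+_ (mod4-×′ (3 ℕ.* k)) (sym (-‿inverseʳ (k ×′ 1#))) ⟩
    (3 ℕ.* k) ×′ 1# + (k ×′ 1# + - (k ×′ 1#))   ≡⟨ +-assoc _ _ _ ⟨
    (3 ℕ.* k) ×′ 1# + k ×′ 1# + - (k ×′ 1#)     ≡⟨ cong (_+ - (k ×′ 1#)) (×′-homo-+ 1# (3 ℕ.* k) k) ⟨
    (3 ℕ.* k ℕ.+ k) ×′ 1# + - (k ×′ 1#)         ≡⟨ cong (λ l → l ×′ 1# + - (k ×′ 1#)) (ℕ.+-comm (3 ℕ.* k) k) ⟩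
    (4 ℕ.* k) ×′ 1# + - (k ×′ 1#)               ≡⟨ cong (_+ - (k ×′ 1#)) (×′1-homo-* 4 k) ⟩
    (4 ×′ 1#) * (k ×′ 1#) + - (k ×′ 1#)         ≡⟨ cong (λ z → z * (k ×′ 1#) + - (k ×′ 1#)) (mod4-×′ 4) ⟨
    0# * (k ×′ 1#) + - (k ×′ 1#)                ≡⟨ cong (_+ - (k ×′ 1#)) (zeroˡ _) ⟩
    0# + - (k ×′ 1#)                            ≡⟨ +-identityˡ _ ⟩
    - (k ×′ 1#)                                 ∎

  ℤ₄⟶R : ℤ₄ -Raw-AlmostCommutative⟶ fromCommutativeRing commutativeRing
  ℤ₄⟶R = record
    { ⟦_⟧    = _×′ 1#
    ; +-homo = λ k l → trans (mod4-×′ (k ℕ.+ l)) (×′-homo-+ 1# k l)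
    ; *-homo = λ k l → trans (mod4-×′ (k ℕ.* l)) (×′1-homo-* k l)
    ; -‿homo = ℤ₄-neg
    ; 0-homo = refl
    ; 1-homo = refl
    }

  ℤ₄≟ : ∀ k l → Maybe (k ×′ 1# ≡ l ×′ 1#)
  ℤ₄≟ k l with k ℕ.≟ l
  ... | yes eq = just (cong (_×′ 1#) eq)
  ... | no _   = nothing

  private module R = RingSolver ℤ₄ (fromCommutativeRing commutativeRing) ℤ₄⟶R ℤ₄≟
  open R using (Polynomial; _:=_; _:+_; _:*_; :-_; con)

  -- Comparing normal forms syntactically is much cheaper than comparing their values in R.

  solve : ∀ n (f : N-ary n (Polynomial n) (Polynomial n × Polynomial n)) →
          (let p = f $ⁿ Vec.map R.var (Vec.allFin n)) → R.normalise (proj₁ p) ≡ R.normalise (proj₂ p) →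
          Eq n _≡_ (curryⁿ R.⟦ proj₁ p ⟧) (curryⁿ R.⟦ proj₂ p ⟧)
  solve n f eq = curryⁿ-cong _≡_ R.⟦ proj₁ p ⟧ R.⟦ proj₂ p ⟧
      (λ ρ → R.prove ρ (proj₁ p) (proj₂ p) (cong (λ e → R.⟦ e ⟧N ρ) eq))
    where p = f $ⁿ Vec.map R.var (Vec.allFin n)

  -- Congruence modulo 2R is expressed by the equation 2x ≡ 2y, since the annihilator of 2 is 2R.

  2*≡0⇒∃ : ∀ {x} → 2# * x ≡ 0# → ∃[ y ] x ≡ 2# * y
  2*≡0⇒∃ {x} eq = Equivalence.to (zeroDivisors x) (2# , 2≢0 , trans (*-comm x 2#) eq)

  ≡₂⇒∃ : ∀ {x y} → 2# * x ≡ 2# * y → ∃[ z ] x ≡ y + 2# * z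
  ≡₂⇒∃ {x} {y} eq = let z , d≡ = 2*≡0⇒∃ 2d≡0 in
    z , trans (solve 2 (λ x y → x := y :+ (x :+ :- y)) refl x y) (cong (y +_) d≡)
    where
    2d≡0 : 2# * (x + - y) ≡ 0#
    2d≡0 = begin
      2# * (x + - y)    ≡⟨ solve 2 (λ x y → con 2 :* (x :+ :- y) := con 2 :* x :+ con 2 :* y) refl x y ⟩
      2# * x + 2# * y   ≡⟨ cong (_+ 2# * y) eq ⟩
      2# * y + 2# * y   ≡⟨ solve 1 (λ y → con 2 :* y :+ con 2 :* y := con 0) refl y ⟩
      0#                ∎

  -- In (y + 2z)² = y² + 4yz + 4z² the last two terms vanish: one squaring lifts a congruence modulo
  -- 2 to an equality.
  ≡₂-square : ∀ {x y} → 2# * x ≡ 2# * y → x * x ≡ y * y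
  ≡₂-square {x} {y} eq = let z , x≡ = ≡₂⇒∃ eq in
    trans (cong (λ s → s * s) x≡)
      (solve 2 (λ y z → (y :+ con 2 :* z) :* (y :+ con 2 :* z) := y :* y) refl y z)

  ≡₂-* : ∀ {w x y z} → 2# * w ≡ 2# * x → 2# * y ≡ 2# * z → 2# * (w * y) ≡ 2# * (x * z)
  ≡₂-* {w} {x} {y} {z} p r = begin
    2# * (w * y) ≡⟨ *-assoc 2# w y ⟨
    2# * w * y   ≡⟨ cong (_* y) p ⟩
    2# * x * y   ≡⟨ solve 2 (λ x y → con 2 :* x :* y := x :* (con 2 :* y)) refl x y ⟩
    x * (2# * y) ≡⟨ cong (x *_) r ⟩
    x * (2# * z) ≡⟨ solve 2 (λ x z → x :* (con 2 :* z) := con 2 :* (x :* z)) refl x z ⟩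
    2# * (x * z) ∎

  +2*≡₂ : ∀ x z → 2# * (x + 2# * z) ≡ 2# * x
  +2*≡₂ = solve 2 (λ x z → con 2 :* (x :+ con 2 :* z) := con 2 :* x) refl

  ≡₂-^ : ∀ {x y} → 2# * x ≡ 2# * y → ∀ k → 2# * x ^ k ≡ 2# * y ^ k
  ≡₂-^ eq zero    = refl
  ≡₂-^ eq (suc k) = ≡₂-* eq (≡₂-^ eq k)

  ^2 : ∀ x → x ^ 2 ≡ x * x
  ^2 x = cong (x *_) (*-identityʳ x)

  ^-double : ∀ x k → x ^ (2 ℕ.* k) ≡ x ^ k * x ^ k
  ^-double x k = trans (cong (λ l → x ^ (k ℕ.+ l)) (ℕ.+-identityʳ k)) (^-homo-* x k k)

  -- The first of the k + 1 squarings already gives equality. For k + 1 = n this says that the q-th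
  -- power depends only on the class modulo 2.
  ≡₂-^2^ : ∀ {x y} → 2# * x ≡ 2# * y → ∀ k → x ^ (2 ℕ.^ suc k) ≡ y ^ (2 ℕ.^ suc k)
  ≡₂-^2^ {x} {y} eq k = begin
    x ^ (2 ℕ.^ suc k)   ≡⟨ ^-assocʳ x 2 (2 ℕ.^ k) ⟨
    (x ^ 2) ^ (2 ℕ.^ k) ≡⟨ cong (_^ (2 ℕ.^ k)) (trans (^2 x) (trans (≡₂-square eq) (sym (^2 y)))) ⟩
    (y ^ 2) ^ (2 ℕ.^ k) ≡⟨ ^-assocʳ y 2 (2 ℕ.^ k) ⟩
    y ^ (2 ℕ.^ suc k)   ∎

  -- Each squaring kills the cross term `2# * Z` of the previous stage, because 4 = 0, and creates
  -- the new one 2XY. For the exponent q this is the cross term in the definition of `⊕`.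
  ^2^-+ : ∀ x y k → (x + y) ^ (2 ℕ.^ suc k) ≡
          x ^ (2 ℕ.^ suc k) + y ^ (2 ℕ.^ suc k) + 2# * (x * y) ^ (2 ℕ.^ k)
  ^2^-+ x y zero = solve 2 (λ x y → (x :+ y) :* ((x :+ y) :* con 1) :=
    x :* (x :* con 1) :+ y :* (y :* con 1) :+ con 2 :* (x :* y :* con 1)) refl x y
  ^2^-+ x y (suc k) = begin
    (x + y) ^ (2 ℕ.^ suc (suc k))           ≡⟨ ^-double (x + y) K ⟩
    (x + y) ^ K * (x + y) ^ K               ≡⟨ cong (λ s → s * s) (^2^-+ x y k) ⟩
    (X + Y + 2# * Z) * (X + Y + 2# * Z)     ≡⟨ solve 3 (λ X Y Z → (X :+ Y :+ con 2 :* Z) :* (X :+ Y :+ con 2 :* Z) :=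
                                                  X :* X :+ Y :* Y :+ con 2 :* (X :* Y)) refl X Y Z ⟩
    X * X + Y * Y + 2# * (X * Y)            ≡⟨ cong₂ _+_ (cong₂ _+_ (^-double x K) (^-double y K))
                                                         (cong (2# *_) (^-distrib-* x y K)) ⟨
    x ^ (2 ℕ.* K) + y ^ (2 ℕ.* K) + 2# * (x * y) ^ K ∎
    where
    K = 2 ℕ.^ suc k
    X = x ^ K
    Y = y ^ K
    Z = (x * y) ^ (2 ℕ.^ k)

  1≢0 : 1# ≢ 0#
  1≢0 eq = 2≢0 (trans (cong₂ _+_ eq eq) (+-identityˡ 0#))

  1^ : ∀ k → 1# ^ k ≡ 1#
  1^ zero    = refl
  1^ (suc k) = trans (*-identityˡ _) (1^ k)

  -- The Teichmüller system

  q m : ℕ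
  q = 2 ℕ.^ suc n′
  m = q ∸ 1

  suc-m : suc m ≡ q
  suc-m = ℕ.m+[n∸m]≡n {1} {q} (ℕ.m^n>0 2 (suc n′))

  0^2^ : ∀ k → 0# ^ (2 ℕ.^ k) ≡ 0#
  0^2^ k = trans (cong (0# ^_) (sym (ℕ.m+[n∸m]≡n {1} (ℕ.m^n>0 2 k)))) (zeroˡ _)

  ξ^m : ξ ^ m ≡ 1#
  ξ^m = proj₁ ξ-order

  T⇒^q : ∀ {a} → T a → a ^ q ≡ a
  T⇒^q (inj₁ (i , refl)) = begin
    (ξ ^ toℕ i) ^ q ≡⟨ ^-assocʳ ξ (toℕ i) q ⟩
    ξ ^ (toℕ i ℕ.* q) ≡⟨ cong (ξ ^_) (ℕ.*-comm (toℕ i) q) ⟩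
    ξ ^ (q ℕ.* toℕ i) ≡⟨ ^-assocʳ ξ q (toℕ i) ⟨
    (ξ ^ q) ^ toℕ i ≡⟨ cong (_^ toℕ i) (trans (cong (ξ ^_) (sym suc-m)) (trans (cong (ξ *_) ξ^m) (*-identityʳ ξ))) ⟩
    ξ ^ toℕ i ∎
  T⇒^q (inj₂ refl) = 0^2^ (suc n′)

  -- Elements of T are their own q-th powers, and the q-th power sees only the class modulo 2. So T
  -- meets each class at most once.
  T-≡₂⇒≡ : ∀ {a b} → T a → T b → 2# * a ≡ 2# * b → a ≡ b
  T-≡₂⇒≡ Ta Tb eq = trans (sym (T⇒^q Ta)) (trans (≡₂-^2^ eq n′) (T⇒^q Tb))

  ξ^-inverse : ∀ {i} → i ℕ.≤ m → ξ ^ i * ξ ^ (m ∸ i) ≡ 1#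
  ξ^-inverse {i} i≤m = trans (sym (^-homo-* ξ i (m ∸ i))) (trans (cong (ξ ^_) (ℕ.m+[n∸m]≡n i≤m)) ξ^m)

  ξ^≢0 : ∀ {i} → i ℕ.≤ m → ξ ^ i ≢ 0#
  ξ^≢0 {i} i≤m eq = 1≢0 (trans (sym (ξ^-inverse i≤m)) (trans (cong (_* ξ ^ (m ∸ i)) eq) (zeroˡ _)))

  ξ^-distinct : ∀ {i j} → i ℕ.< j → j ℕ.< m → ξ ^ i ≢ ξ ^ j
  ξ^-distinct {i} {j} i<j j<m eq =
    proj₂ ξ-order (j ∸ i) (ℕ.m<n⇒0<n∸m i<j) (ℕ.≤-<-trans (ℕ.m∸n≤m j i) j<m) (begin
      ξ ^ (j ∸ i)                          ≡⟨ *-identityʳ _ ⟨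
      ξ ^ (j ∸ i) * 1#                     ≡⟨ cong (ξ ^ (j ∸ i) *_) (ξ^-inverse i≤m) ⟨
      ξ ^ (j ∸ i) * (ξ ^ i * ξ ^ (m ∸ i))  ≡⟨ *-assoc (ξ ^ (j ∸ i)) _ _ ⟨
      ξ ^ (j ∸ i) * ξ ^ i * ξ ^ (m ∸ i)    ≡⟨ cong (_* ξ ^ (m ∸ i)) (^-homo-* ξ (j ∸ i) i) ⟨
      ξ ^ (j ∸ i ℕ.+ i) * ξ ^ (m ∸ i)      ≡⟨ cong (λ k → ξ ^ k * ξ ^ (m ∸ i)) (ℕ.m∸n+n≡m (ℕ.<⇒≤ i<j)) ⟩
      ξ ^ j * ξ ^ (m ∸ i)                  ≡⟨ cong (_* ξ ^ (m ∸ i)) eq ⟨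
      ξ ^ i * ξ ^ (m ∸ i)                  ≡⟨ ξ^-inverse i≤m ⟩
      1#                                   ∎)
    where i≤m = ℕ.<⇒≤ (ℕ.<-trans i<j j<m)

  -- Keeping 0 at the head makes every sum over `Ts` split by computation into the term at 0 and the
  -- sum over the powers of ξ.
  T*s Ts : List Carrier
  T*s = map (λ i → ξ ^ toℕ i) (allFin m)
  Ts = 0# ∷ T*s

  ∈Ts⇒T : ∀ {x} → x ∈ Ts → T x
  ∈Ts⇒T (here x≡0) = inj₂ x≡0
  ∈Ts⇒T (there x∈) = let i , _ , x≡ = ∈-map⁻ _ x∈ in inj₁ (i , x≡)

  T⇒∈Ts : ∀ {x} → T x → x ∈ Ts
  T⇒∈Ts (inj₁ (i , refl)) = there (∈-map⁺ _ (∈-allFin i))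
  T⇒∈Ts (inj₂ x≡0)        = here x≡0

  T*s≢0 : ∀ {x} → x ∈ T*s → x ≢ 0#
  T*s≢0 x∈ x≡0 = let i , _ , x≡ = ∈-map⁻ _ x∈ in
    ξ^≢0 (ℕ.<⇒≤ (Fin.toℕ<n i)) (trans (sym x≡) x≡0)

  Ts-unique : Unique Ts
  Ts-unique = ∉⇒All≢ (λ x∈ 0≡x → T*s≢0 x∈ (sym 0≡x)) ∷ Unique.map⁺ inj (Unique.allFin⁺ m)
    where
    inj : ∀ {i j : Fin m} → ξ ^ toℕ i ≡ ξ ^ toℕ j → i ≡ j
    inj {i} {j} eq with ℕ.<-cmp (toℕ i) (toℕ j)
    ... | tri< i<j _ _ = ⊥-elim (ξ^-distinct i<j (Fin.toℕ<n j) eq)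
    ... | tri≈ _ i≡j _ = Fin.toℕ-injective i≡j
    ... | tri> _ _ j<i = ⊥-elim (ξ^-distinct j<i (Fin.toℕ<n i) (sym eq))

  length-Ts : length Ts ≡ q
  length-Ts = trans (cong suc (trans (length-map _ (allFin m)) (length-tabulate {n = m} id))) suc-m

  rep : Carrier × Carrier → Carrier
  rep (a , b) = a + 2# * b

  rep-injective : ∀ {a b a′ b′} → T a → T b → T a′ → T b′ → a + 2# * b ≡ a′ + 2# * b′ → a ≡ a′ × b ≡ b′
  rep-injective {a} {b} {a′} {b′} Ta Tb Ta′ Tb′ eq = a≡a′ , T-≡₂⇒≡ Tb Tb′ 2b≡2b′
    where
    a≡a′ : a ≡ a′
    a≡a′ = T-≡₂⇒≡ Ta Ta′ (trans (sym (+2*≡₂ a b)) (trans (cong (2# *_) eq) (+2*≡₂ a′ b′)))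
    2b≡2b′ : 2# * b ≡ 2# * b′
    2b≡2b′ = begin
      -- Here 3a stands for -a, since 4a = 0.
      2# * b                       ≡⟨ solve 2 (λ a b → con 2 :* b := con 3 :* a :+ (a :+ con 2 :* b)) refl a b ⟩
      (2# + 1#) * a + (a + 2# * b)   ≡⟨ cong₂ (λ s t → (2# + 1#) * s + t) a≡a′ eq ⟩
      (2# + 1#) * a′ + (a′ + 2# * b′) ≡⟨ solve 2 (λ a b → con 3 :* a :+ (a :+ con 2 :* b) := con 2 :* b) refl a′ b′ ⟩
      2# * b′                      ∎

  ∈-elements : ∀ x → x ∈ elements
  ∈-elements x = subst (_∈ elements) (from-to x) (∈-map⁺ _ (∈-allFin _))

  elements-unique : Unique elements
  elements-unique = Unique.map⁺ inj (Unique.allFin⁺ (4 ℕ.^ suc n′))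
    where
    module E = Inverse enumeration
    inj : ∀ {i j} → E.from i ≡ E.from j → i ≡ j
    inj {i} {j} eq = trans (sym (E.inverseˡ refl)) (trans (cong E.to eq) (E.inverseˡ refl))

  length-elements : length elements ≡ q ℕ.* q
  length-elements = trans (length-map _ (allFin (4 ℕ.^ suc n′))) (trans (length-tabulate {n = 4 ℕ.^ suc n′} id)
    (trans (ℕ.^-*-assoc 2 2 (suc n′)) (trans (cong (λ k → 2 ℕ.^ (suc n′ ℕ.+ k)) (ℕ.+-identityʳ (suc n′)))
      (ℕ.^-distribˡ-+-* 2 (suc n′) (suc n′)))))

  pairs : List (Carrier × Carrier)
  pairs = cartesianProduct Ts Ts

  ∈pairs⇒T : ∀ {a b} → (a , b) ∈ pairs → T a × T b
  ∈pairs⇒T p∈ = let a∈ , b∈ = ∈-cartesianProduct⁻ Ts Ts p∈ in ∈Ts⇒T a∈ , ∈Ts⇒T b∈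

  -- Counting proves that every element has the form a + 2b: `rep` is injective on the q² pairs from
  -- T, and R has 4^n = q² elements.
  pairs↭elements : map rep pairs ↭ elements
  pairs↭elements = unique-⊆-↭
    (unique-map rep
      (λ p∈ p′∈ eq → let Ta , Tb = ∈pairs⇒T p∈ ; Ta′ , Tb′ = ∈pairs⇒T p′∈ in
                     ×-≡,≡→≡ (rep-injective Ta Tb Ta′ Tb′ eq))
      (Unique.cartesianProduct⁺ Ts-unique Ts-unique))
    (λ {x} _ → ∈-elements x)
    (trans (length-map rep pairs) (trans (length-cartesianProduct Ts Ts)
      (trans (cong₂ ℕ._*_ length-Ts length-Ts) (sym length-elements))))

  decompose : ∀ x → ∃[ a ] ∃[ b ] (T a × T b × x ≡ a + 2# * b)
  decompose x = unpack (∈-map⁻ rep (∈-resp-↭ (↭-sym pairs↭elements) (∈-elements x)))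
    where
    unpack : ∃[ p ] (p ∈ pairs × x ≡ rep p) → ∃[ a ] ∃[ b ] (T a × T b × x ≡ a + 2# * b)
    unpack ((a , b) , p∈ , x≡) = a , b , proj₁ (∈pairs⇒T p∈) , proj₂ (∈pairs⇒T p∈) , x≡

  N : ℕ
  N = 2 ℕ.^ n′

  private module ∑R = ListSum isCommutativeRing
  open ∑R using (∑[_])

  -- With x = a + 2b one gets x^q = a^q = a, so the q-th power is the Teichmüller representative of
  -- the class of x.
  ^q∈T : ∀ x → T (x ^ q)
  ^q∈T x = let a , b , Ta , _ , x≡ = decompose x in
    subst T (trans (sym (T⇒^q Ta)) (≡₂-^2^ (sym (trans (cong (2# *_) x≡) (+2*≡₂ a b))) n′)) Ta

  ^q≡₂ : ∀ x → 2# * x ^ q ≡ 2# * x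
  ^q≡₂ x = let a , b , Ta , _ , x≡ = decompose x
               2x≡2a = trans (cong (2# *_) x≡) (+2*≡₂ a b) in
    trans (cong (2# *_) (trans (≡₂-^2^ 2x≡2a n′) (T⇒^q Ta))) (sym 2x≡2a)

  -- Together with `T⇒^q` this describes T as the fixed points of the q-th power, which gives
  -- closure under products without computing with exponents of ξ.
  ^q≡⇒T : ∀ {x} → x ^ q ≡ x → T x
  ^q≡⇒T {x} eq = subst T eq (^q∈T x)

  T-* : ∀ {a b} → T a → T b → T (a * b)
  T-* {a} {b} Ta Tb = ^q≡⇒T (trans (^-distrib-* a b q) (cong₂ _*_ (T⇒^q Ta) (T⇒^q Tb)))

  T-0 : T 0#
  T-0 = inj₂ refl

  T-1 : T 1#
  T-1 = ^q≡⇒T (1^ q)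

  T-^ : ∀ {a} → T a → ∀ k → T (a ^ k)
  T-^ Ta zero    = T-1
  T-^ Ta (suc k) = T-* Ta (T-^ Ta k)

  -- Field addition on T is the sum in R followed by passage to the Teichmüller representative;
  -- `^2^-+` at the exponent q produces the term 2√(ab).
  ⊕≡^q : ∀ {a b} → T a → T b → a ⊕ b ≡ (a + b) ^ q
  ⊕≡^q {a} {b} Ta Tb = begin
    a + b + 2# * √ (a * b)          ≡⟨ cong (_+ 2# * √ (a * b)) (cong₂ _+_ (T⇒^q Ta) (T⇒^q Tb)) ⟨
    a ^ q + b ^ q + 2# * √ (a * b)  ≡⟨ ^2^-+ a b n′ ⟨
    (a + b) ^ q                     ∎

  T-⊕ : ∀ {a b} → T a → T b → T (a ⊕ b)
  T-⊕ Ta Tb = subst T (sym (⊕≡^q Ta Tb)) (^q∈T _)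

  ⊕≡₂ : ∀ a b → 2# * (a ⊕ b) ≡ 2# * (a + b)
  ⊕≡₂ a b = +2*≡₂ (a + b) (√ (a * b))

  √-square : ∀ {a} → T a → √ a * √ a ≡ a
  √-square {a} Ta = trans (sym (^-double a N)) (T⇒^q Ta)

  T-√ : ∀ {a} → T a → T (√ a)
  T-√ Ta = T-^ Ta N

  T-nonzero-inverse : ∀ {a} → T a → a ≢ 0# → ∃[ b ] a * b ≡ 1#
  T-nonzero-inverse (inj₁ (i , refl)) a≢0 = ξ ^ (m ∸ toℕ i) , ξ^-inverse (ℕ.<⇒≤ (Fin.toℕ<n i))
  T-nonzero-inverse (inj₂ a≡0)        a≢0 = ⊥-elim (a≢0 a≡0)

  -- The Frobenius automorphism σ and the trace

  ∈elements-T : ∀ {x} → T x → x ∈ filter T? elements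
  ∈elements-T Tx = ∈-filter⁺ T? (∈-elements _) Tx

  -- The search in `σ` may meet any pair representing the element, and `rep-injective` leaves only
  -- (a , b).
  σ-T+2T : ∀ {a b} → T a → T b → σ (a + 2# * b) ≡ a ^ 2 + 2# * b ^ 2
  σ-T+2T {a} {b} Ta Tb = conclude (find-just (λ p → a + 2# * b ≟ proj₁ p + 2# * proj₂ p)
      (∈-cartesianProduct⁺ (∈elements-T Ta) (∈elements-T Tb)) refl)
    where
    TT : List (Carrier × Carrier)
    TT = cartesianProduct (filter T? elements) (filter T? elements)
    out : Carrier × Carrier → Carrier
    out p = proj₁ p ^ 2 + 2# * proj₂ p ^ 2
    same : ∀ {v} → v ∈ TT → a + 2# * b ≡ proj₁ v + 2# * proj₂ v → out v ≡ out (a , b)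
    same {a′ , b′} v∈ eq =
      let a′∈ , b′∈ = ∈-cartesianProduct⁻ (filter T? elements) (filter T? elements) v∈
          a≡ , b≡ = rep-injective Ta Tb (proj₂ (∈-filter⁻ T? {xs = elements} a′∈))
                                        (proj₂ (∈-filter⁻ T? {xs = elements} b′∈)) eq
      in cong₂ (λ s t → s ^ 2 + 2# * t ^ 2) (sym a≡) (sym b≡)
    conclude : ∃ (λ v → find (λ p → a + 2# * b ≟ proj₁ p + 2# * proj₂ p) TT ≡ just v
                      × v ∈ TT × a + 2# * b ≡ proj₁ v + 2# * proj₂ v) →
               σ (a + 2# * b) ≡ a ^ 2 + 2# * b ^ 2
    conclude (v , found , v∈ , eq) = trans (cong (maybe′ out 0#) found) (same v∈ eq)

  -- Only the class of b modulo 2 enters, so b is replaced by b^q ∈ T. Additivity of `σ` needs this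
  -- freedom, as sums of second components leave T.
  σ-T+2* : ∀ {a} → T a → ∀ b → σ (a + 2# * b) ≡ a * a + 2# * (b * b)
  σ-T+2* {a} Ta b = begin
    σ (a + 2# * b)                  ≡⟨ cong (λ s → σ (a + s)) (^q≡₂ b) ⟨
    σ (a + 2# * b ^ q)              ≡⟨ σ-T+2T Ta (^q∈T b) ⟩
    a ^ 2 + 2# * (b ^ q) ^ 2        ≡⟨ cong₂ (λ s t → s + 2# * t) (^2 a) (^2 (b ^ q)) ⟩
    a * a + 2# * (b ^ q * b ^ q)    ≡⟨ cong (λ s → a * a + s) (≡₂-* (^q≡₂ b) (^q≡₂ b)) ⟩
    a * a + 2# * (b * b)            ∎

  σ-+ : ∀ x y → σ (x + y) ≡ σ x + σ y
  σ-+ x y = split (decompose x) (decompose y)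
    where
    split : ∃[ a ] ∃[ b ] (T a × T b × x ≡ a + 2# * b) → ∃[ a ] ∃[ b ] (T a × T b × y ≡ a + 2# * b) →
            σ (x + y) ≡ σ x + σ y
    split (a , b , Ta , Tb , x≡) (a′ , b′ , Ta′ , Tb′ , y≡) = begin
      σ (x + y)
        -- With r = √(aa′), a + a′ = (a ⊕ a′) + 2r because -2r = 2r. Under `σ` this carry
        -- contributes 2r² = 2aa′, which cancels the cross term of (a + a′)².
        ≡⟨ cong σ (trans (cong₂ _+_ x≡ y≡) (solve 5 (λ a b a′ b′ r →
             (a :+ con 2 :* b) :+ (a′ :+ con 2 :* b′) := (a :+ a′ :+ con 2 :* r) :+ con 2 :* (r :+ b :+ b′))
             refl a b a′ b′ r)) ⟩
      σ (a ⊕ a′ + 2# * (r + b + b′))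
        ≡⟨ σ-T+2* (T-⊕ Ta Ta′) (r + b + b′) ⟩
      (a ⊕ a′) * (a ⊕ a′) + 2# * ((r + b + b′) * (r + b + b′))
        ≡⟨ cong₂ _+_ (≡₂-square (⊕≡₂ a a′)) (solve 3 (λ r b b′ →
             con 2 :* ((r :+ b :+ b′) :* (r :+ b :+ b′)) := con 2 :* (r :* r) :+ con 2 :* (b :* b) :+ con 2 :* (b′ :* b′)) refl r b b′) ⟩
      (a + a′) * (a + a′) + (2# * (r * r) + 2# * (b * b) + 2# * (b′ * b′))
        ≡⟨ cong (λ s → (a + a′) * (a + a′) + (2# * s + 2# * (b * b) + 2# * (b′ * b′))) (√-square (T-* Ta Ta′)) ⟩
      (a + a′) * (a + a′) + (2# * (a * a′) + 2# * (b * b) + 2# * (b′ * b′))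
        ≡⟨ solve 4 (λ a b a′ b′ → (a :+ a′) :* (a :+ a′) :+ (con 2 :* (a :* a′) :+ con 2 :* (b :* b) :+ con 2 :* (b′ :* b′))
             := (a :* a :+ con 2 :* (b :* b)) :+ (a′ :* a′ :+ con 2 :* (b′ :* b′))) refl a b a′ b′ ⟩
      (a * a + 2# * (b * b)) + (a′ * a′ + 2# * (b′ * b′))
        ≡⟨ cong₂ _+_ (trans (cong σ x≡) (σ-T+2* Ta b)) (trans (cong σ y≡) (σ-T+2* Ta′ b′)) ⟨
      σ x + σ y ∎
      where r = √ (a * a′)

  σ-0 : σ 0# ≡ 0#
  σ-0 = begin
    σ 0#                   ≡⟨ cong σ (solve 0 (con 0 := con 0 :+ con 2 :* con 0) refl) ⟩
    σ (0# + 2# * 0#)       ≡⟨ σ-T+2* T-0 0# ⟩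
    0# * 0# + 2# * (0# * 0#) ≡⟨ solve 0 (con 0 :* con 0 :+ con 2 :* (con 0 :* con 0) := con 0) refl ⟩
    0# ∎

  σ^-+ : ∀ i x y → σ^ i (x + y) ≡ σ^ i x + σ^ i y
  σ^-+ zero    x y = refl
  σ^-+ (suc i) x y = trans (cong σ (σ^-+ i x y)) (σ-+ (σ^ i x) (σ^ i y))

  ^2^-suc : ∀ x i → (x ^ (2 ℕ.^ i)) ^ 2 ≡ x ^ (2 ℕ.^ suc i)
  ^2^-suc x i = trans (^-assocʳ x (2 ℕ.^ i) 2) (cong (x ^_) (ℕ.*-comm (2 ℕ.^ i) 2))

  σ^-T+2T : ∀ {a b} → T a → T b → ∀ i → σ^ i (a + 2# * b) ≡ a ^ (2 ℕ.^ i) + 2# * b ^ (2 ℕ.^ i)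
  σ^-T+2T {a} {b} Ta Tb zero    = sym (cong₂ (λ s t → s + 2# * t) (*-identityʳ a) (*-identityʳ b))
  σ^-T+2T {a} {b} Ta Tb (suc i) = begin
    σ (σ^ i (a + 2# * b))                        ≡⟨ cong σ (σ^-T+2T Ta Tb i) ⟩
    σ (a ^ (2 ℕ.^ i) + 2# * b ^ (2 ℕ.^ i))       ≡⟨ σ-T+2T (T-^ Ta (2 ℕ.^ i)) (T-^ Tb (2 ℕ.^ i)) ⟩
    (a ^ (2 ℕ.^ i)) ^ 2 + 2# * (b ^ (2 ℕ.^ i)) ^ 2 ≡⟨ cong₂ (λ s t → s + 2# * t) (^2^-suc a i) (^2^-suc b i) ⟩
    a ^ (2 ℕ.^ suc i) + 2# * b ^ (2 ℕ.^ suc i)   ∎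

  σ^-T : ∀ {a} → T a → ∀ i → σ^ i a ≡ a ^ (2 ℕ.^ i)
  σ^-T {a} Ta i = begin
    σ^ i a                       ≡⟨ cong (σ^ i) (solve 1 (λ a → a := a :+ con 2 :* con 0) refl a) ⟩
    σ^ i (a + 2# * 0#)           ≡⟨ σ^-T+2T Ta T-0 i ⟩
    a ^ (2 ℕ.^ i) + 2# * 0# ^ (2 ℕ.^ i) ≡⟨ cong (λ s → a ^ (2 ℕ.^ i) + 2# * s) (0^2^ i) ⟩
    a ^ (2 ℕ.^ i) + 2# * 0#      ≡⟨ solve 1 (λ a → a :+ con 2 :* con 0 := a) refl _ ⟩
    a ^ (2 ℕ.^ i)                ∎

  σ^-n : ∀ x → σ^ (suc n′) x ≡ x
  σ^-n x = unpack (decompose x)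
    where
    unpack : ∃[ a ] ∃[ b ] (T a × T b × x ≡ a + 2# * b) → σ^ (suc n′) x ≡ x
    unpack (a , b , Ta , Tb , refl) = trans (σ^-T+2T Ta Tb (suc n′)) (cong₂ (λ s t → s + 2# * t) (T⇒^q Ta) (T⇒^q Tb))

  trace-+ : ∀ x y → trace (x + y) ≡ trace x + trace y
  trace-+ x y = trans (∑R.∑-cong (upTo (suc n′)) (λ {i} _ → σ^-+ i x y)) (∑R.∑-distrib-+ _ _ (upTo (suc n′)))

  σ-∑ : ∀ (g : ℕ → Carrier) xs → σ (∑[ xs ] g) ≡ ∑[ xs ] (σ ∘ g)
  σ-∑ g []       = σ-0
  σ-∑ g (x ∷ xs) = trans (σ-+ (g x) _) (cong (σ (g x) +_) (σ-∑ g xs))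

  +-cancelʳ : ∀ x y z → x + z ≡ y + z → x ≡ y
  +-cancelʳ x y z eq = begin
    x              ≡⟨ solve 2 (λ x z → x := x :+ z :+ :- z) refl x z ⟩
    x + z + - z    ≡⟨ cong (_+ - z) eq ⟩
    y + z + - z    ≡⟨ solve 2 (λ x z → x :+ z :+ :- z := x) refl y z ⟩
    y              ∎

  -- `σ` moves the summands one place along a cycle, which σ^n x = x closes. Adding x on both sides
  -- brings the two sums into the form of `applyUpTo-shift`.
  σ-trace : ∀ x → σ (trace x) ≡ trace x
  σ-trace x = +-cancelʳ _ _ x (begin
    σ (trace x) + x
      ≡⟨ cong (_+ x) (σ-∑ (λ i → σ^ i x) (upTo (suc n′))) ⟩
    foldr _+_ 0# (map (λ i → σ^ (suc i) x) (upTo (suc n′))) + x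
      ≡⟨ cong (λ l → foldr _+_ 0# l + x) (map-upTo (λ i → σ^ (suc i) x) (suc n′)) ⟩
    foldr _+_ 0# (applyUpTo (λ i → σ^ (suc i) x) (suc n′)) + x
      ≡⟨ ∑R.applyUpTo-shift (λ i → σ^ i x) (suc n′) ⟩
    foldr _+_ 0# (applyUpTo (λ i → σ^ i x) (suc n′)) + σ^ (suc n′) x
      ≡⟨ cong₂ (λ l s → foldr _+_ 0# l + s) (map-upTo (λ i → σ^ i x) (suc n′)) (sym (σ^-n x)) ⟨
    trace x + x ∎)

  T-idempotent : ∀ {a} → T a → a * a ≡ a → a ≡ 0# ⊎ a ≡ 1#
  T-idempotent {a} Ta aa≡a with a ≟ 0#
  ... | yes a≡0 = inj₁ a≡0
  ... | no  a≢0 = let b , ab≡1 = T-nonzero-inverse Ta a≢0 in inj₂ (begin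
    a            ≡⟨ *-identityʳ a ⟨
    a * 1#       ≡⟨ cong (a *_) ab≡1 ⟨
    a * (a * b)  ≡⟨ *-assoc a a b ⟨
    a * a * b    ≡⟨ cong (_* b) aa≡a ⟩
    a * b        ≡⟨ ab≡1 ⟩
    1#           ∎)

  -- Uniqueness of a + 2b turns σ x = x into a² = a and b² = b, so a, b ∈ {0, 1}. Together with
  -- `σ-trace` this is why the search in `Tr` succeeds.
  σ-fixed : ∀ {x} → σ x ≡ x → ∃[ k ] (k ∈ upTo 4 × x ≡ k · 1#)
  σ-fixed {x} σx≡x = unpack (decompose x)
    where
    unpack : ∃[ a ] ∃[ b ] (T a × T b × x ≡ a + 2# * b) → ∃[ k ] (k ∈ upTo 4 × x ≡ k · 1#)
    unpack (a , b , Ta , Tb , x≡) = values (T-idempotent Ta (proj₁ idem)) (T-idempotent Tb (proj₂ idem))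
      where
      idem : a * a ≡ a × b * b ≡ b
      idem = rep-injective (T-* Ta Ta) (T-* Tb Tb) Ta Tb
               (trans (sym (σ-T+2* Ta b)) (trans (cong σ (sym x≡)) (trans σx≡x x≡)))
      values : a ≡ 0# ⊎ a ≡ 1# → b ≡ 0# ⊎ b ≡ 1# → ∃[ k ] (k ∈ upTo 4 × x ≡ k · 1#)
      values (inj₁ a≡) (inj₁ b≡) = 0 , here refl ,
        trans x≡ (trans (cong₂ (λ s t → s + 2# * t) a≡ b≡) (solve 0 (con 0 :+ con 2 :* con 0 := con 0) refl))
      values (inj₂ a≡) (inj₁ b≡) = 1 , there (here refl) ,
        trans x≡ (trans (cong₂ (λ s t → s + 2# * t) a≡ b≡) (solve 0 (con 1 :+ con 2 :* con 0 := con 1 :+ con 0) refl))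
      values (inj₁ a≡) (inj₂ b≡) = 2 , there (there (here refl)) ,
        trans x≡ (trans (cong₂ (λ s t → s + 2# * t) a≡ b≡) (solve 0 (con 0 :+ con 2 :* con 1 := con 1 :+ (con 1 :+ con 0)) refl))
      values (inj₂ a≡) (inj₂ b≡) = 3 , there (there (there (here refl))) ,
        trans x≡ (trans (cong₂ (λ s t → s + 2# * t) a≡ b≡) (solve 0 (con 1 :+ con 2 :* con 1 := con 1 :+ (con 1 :+ (con 1 :+ con 0))) refl))

  trace≡Tr : ∀ x → trace x ≡ Tr x · 1#
  trace≡Tr x = let k , k∈ , eq = σ-fixed (σ-trace x) in conclude (find-just (λ k → trace x ≟ k · 1#) k∈ eq)
    where
    conclude : ∃ (λ v → find (λ k → trace x ≟ k · 1#) (upTo 4) ≡ just v × v ∈ upTo 4 × trace x ≡ v · 1#) →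
               trace x ≡ Tr x · 1#
    conclude (v , found , _ , eq) = trans eq (cong (λ k → maybe′ (λ k → k) 0 k · 1#) (sym found))

  ∑-const-1 : ∀ {b} {B : Set b} (xs : List B) → ∑[ xs ] (λ _ → 1#) ≡ length xs · 1#
  ∑-const-1 []       = refl
  ∑-const-1 (_ ∷ xs) = cong (1# +_) (∑-const-1 xs)

  0<m : 0 ℕ.< m
  0<m = ℕ.∸-monoˡ-≤ 1 (ℕ.^-monoʳ-≤ 2 {1} {suc n′} (s≤s z≤n))

  -- Multiplying by r shifts the sum cyclically, so (r - 1) S = 0. In a ring with zero divisors r ≠
  -- 1 alone does not give S = 0; but if S ≠ 0 then r - 1 ∈ 2R, and elements of T congruent modulo 2
  -- are equal.
  geometric-sum : ∀ {r} → T r → r ≢ 1# → r ^ m ≡ 1# → ∑[ allFin m ] (λ j → r ^ toℕ j) ≡ 0#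
  geometric-sum {r} Tr r≢1 r^m≡1 = decidable-stable (S ≟ 0#) λ S≢0 →
      let y , r-1≡2y = Equivalence.to (zeroDivisors (r + - 1#)) (S , S≢0 , [r-1]S≡0)
      in r≢1 (T-≡₂⇒≡ Tr T-1 (trans (cong (2# *_) (trans
           (solve 1 (λ r → r := con 1 :+ (r :+ :- con 1)) refl r) (cong (1# +_) r-1≡2y))) (+2*≡₂ 1# y)))
    where
    S = ∑[ allFin m ] (λ j → r ^ toℕ j)
    S≡ : S ≡ foldr _+_ 0# (applyUpTo (r ^_) m)
    S≡ = cong (foldr _+_ 0#) (map-allFin (r ^_) m)
    rS≡ : r * S ≡ foldr _+_ 0# (applyUpTo (λ i → r ^ suc i) m)
    rS≡ = trans (sym (∑R.∑-distrib-* r (λ j → r ^ toℕ j) (allFin m)))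
                (cong (foldr _+_ 0#) (map-allFin (λ i → r ^ suc i) m))
    rS+1≡S+1 : r * S + 1# ≡ S + 1#
    rS+1≡S+1 = begin
      r * S + 1#                                              ≡⟨ cong (_+ 1#) rS≡ ⟩
      foldr _+_ 0# (applyUpTo (λ i → r ^ suc i) m) + 1#       ≡⟨ ∑R.applyUpTo-shift (r ^_) m ⟩
      foldr _+_ 0# (applyUpTo (r ^_) m) + r ^ m               ≡⟨ cong₂ _+_ S≡ (sym r^m≡1) ⟨
      S + 1#                                                  ∎
    [r-1]S≡0 : (r + - 1#) * S ≡ 0#
    [r-1]S≡0 = begin
      (r + - 1#) * S ≡⟨ solve 2 (λ r S → (r :+ :- con 1) :* S := r :* S :+ :- S) refl r S ⟩
      r * S + - S    ≡⟨ cong (_+ - S) (+-cancelʳ _ _ 1# rS+1≡S+1) ⟩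
      S + - S        ≡⟨ -‿inverseʳ S ⟩
      0#             ∎

  -- The sum of ξ⁻ʲ Tr(ξʲ) over j splits into the geometric sums with ratios ξ^(2ⁱ - 1); only i = 0
  -- contributes, and it gives m = 2ⁿ - 1, which is odd.

  ratio : ℕ → Carrier
  ratio i = ξ ^ (m ∸ 1 ℕ.+ 2 ℕ.^ i)

  private
    m-1+1 : m ∸ 1 ℕ.+ 1 ≡ m
    m-1+1 = ℕ.m∸n+n≡m 0<m

  T-ξ^ : ∀ k → T (ξ ^ k)
  T-ξ^ k = T-^ (^q≡⇒T (trans (cong (ξ ^_) (sym suc-m)) (trans (cong (ξ *_) ξ^m) (*-identityʳ ξ)))) k

  ratio^m : ∀ i → ratio i ^ m ≡ 1#
  ratio^m i = begin
    ratio i ^ m                       ≡⟨ ^-assocʳ ξ (m ∸ 1 ℕ.+ 2 ℕ.^ i) m ⟩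
    ξ ^ ((m ∸ 1 ℕ.+ 2 ℕ.^ i) ℕ.* m)    ≡⟨ cong (ξ ^_) (ℕ.*-comm (m ∸ 1 ℕ.+ 2 ℕ.^ i) m) ⟩
    ξ ^ (m ℕ.* (m ∸ 1 ℕ.+ 2 ℕ.^ i))    ≡⟨ ^-assocʳ ξ m (m ∸ 1 ℕ.+ 2 ℕ.^ i) ⟨
    (ξ ^ m) ^ (m ∸ 1 ℕ.+ 2 ℕ.^ i)      ≡⟨ cong (_^ (m ∸ 1 ℕ.+ 2 ℕ.^ i)) ξ^m ⟩
    1# ^ (m ∸ 1 ℕ.+ 2 ℕ.^ i)           ≡⟨ 1^ (m ∸ 1 ℕ.+ 2 ℕ.^ i) ⟩
    1#                                 ∎

  -- The exponent is 2^(i+1) - 1 modulo m, and this lies strictly between 0 and m because i + 1 < n.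
  ratio≢1 : ∀ i → suc i ℕ.< suc n′ → ratio (suc i) ≢ 1#
  ratio≢1 i i<n eq = proj₂ ξ-order (2 ℕ.^ suc i ∸ 1) 0<e e<m (begin
      ξ ^ e             ≡⟨ *-identityˡ _ ⟨
      1# * ξ ^ e        ≡⟨ cong (_* ξ ^ e) ξ^m ⟨
      ξ ^ m * ξ ^ e     ≡⟨ ^-homo-* ξ m e ⟨
      ξ ^ (m ℕ.+ e)     ≡⟨ cong (ξ ^_) m+e ⟩
      ratio (suc i)     ≡⟨ eq ⟩
      1#                ∎)
    where
    e = 2 ℕ.^ suc i ∸ 1
    0<e : 0 ℕ.< e
    0<e = ℕ.∸-monoˡ-≤ 1 (ℕ.^-monoʳ-≤ 2 {1} {suc i} (s≤s z≤n))
    e<m : e ℕ.< m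
    e<m = ℕ.∸-monoˡ-< (ℕ.^-monoʳ-< 2 (s≤s (s≤s z≤n)) i<n) (ℕ.m^n>0 2 (suc i))
    m+e : m ℕ.+ e ≡ m ∸ 1 ℕ.+ 2 ℕ.^ suc i
    m+e = trans (cong (ℕ._+ e) (sym m-1+1)) (trans (ℕ.+-assoc (m ∸ 1) 1 e)
            (cong (m ∸ 1 ℕ.+_) (ℕ.m+[n∸m]≡n (ℕ.m^n>0 2 (suc i)))))

  ξ^-trace-sum : ∑[ allFin m ] (λ j → (ξ ^ toℕ j) ^ (m ∸ 1) * (2# * trace (ξ ^ toℕ j))) ≡ 2# * (m · 1#)
  ξ^-trace-sum = begin
    ∑[ allFin m ] (λ j → (ξ ^ toℕ j) ^ (m ∸ 1) * (2# * trace (ξ ^ toℕ j)))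
      ≡⟨ ∑R.∑-cong (allFin m) (λ {j} _ → expand (toℕ j)) ⟩
    ∑[ allFin m ] (λ j → ∑[ upTo (suc n′) ] (λ i → 2# * ratio i ^ toℕ j))
      ≡⟨ ∑R.∑-swap _ (allFin m) (upTo (suc n′)) ⟩
    ∑[ upTo (suc n′) ] (λ i → ∑[ allFin m ] (λ j → 2# * ratio i ^ toℕ j))
      ≡⟨ ∑R.∑-cong (upTo (suc n′)) (λ {i} _ → ∑R.∑-distrib-* 2# (λ j → ratio i ^ toℕ j) (allFin m)) ⟩
    ∑[ upTo (suc n′) ] (λ i → 2# * ∑[ allFin m ] (λ j → ratio i ^ toℕ j))
      ≡⟨ cong₂ _+_ (cong (2# *_) (trans (∑R.∑-cong (allFin m) (λ {j} _ → trans (cong (_^ toℕ j) ratio-0) (1^ (toℕ j))))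
                                        (trans (∑-const-1 (allFin m)) (cong (_· 1#) (length-tabulate {n = m} id)))))
                   (∑R.∑-zero _ (applyUpTo suc n′) higher) ⟩
    2# * (m · 1#) + 0# ≡⟨ +-identityʳ _ ⟩
    2# * (m · 1#) ∎
    where
    ratio-0 : ratio 0 ≡ 1#
    ratio-0 = trans (cong (ξ ^_) m-1+1) ξ^m
    higher : ∀ {i} → i ∈ applyUpTo suc n′ → 2# * ∑[ allFin m ] (λ j → ratio i ^ toℕ j) ≡ 0#
    higher i∈ with ∈-applyUpTo⁻ suc i∈
    ... | k , k<n′ , refl = trans (cong (2# *_) (geometric-sum (T-ξ^ (m ∸ 1 ℕ.+ 2 ℕ.^ suc k)) (ratio≢1 k (s≤s k<n′)) (ratio^m (suc k)))) (zeroʳ 2#)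
    term : ∀ j i → (ξ ^ j) ^ (m ∸ 1) * (2# * σ^ i (ξ ^ j)) ≡ 2# * ratio i ^ j
    term j i = begin
      (ξ ^ j) ^ (m ∸ 1) * (2# * σ^ i (ξ ^ j))
        ≡⟨ cong (λ s → (ξ ^ j) ^ (m ∸ 1) * (2# * s)) (σ^-T (T-ξ^ j) i) ⟩
      (ξ ^ j) ^ (m ∸ 1) * (2# * (ξ ^ j) ^ (2 ℕ.^ i))
        ≡⟨ solve 2 (λ x y → x :* (con 2 :* y) := con 2 :* (x :* y)) refl ((ξ ^ j) ^ (m ∸ 1)) ((ξ ^ j) ^ (2 ℕ.^ i)) ⟩
      2# * ((ξ ^ j) ^ (m ∸ 1) * (ξ ^ j) ^ (2 ℕ.^ i))
        ≡⟨ cong (2# *_) (^-homo-* (ξ ^ j) (m ∸ 1) (2 ℕ.^ i)) ⟨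
      2# * (ξ ^ j) ^ (m ∸ 1 ℕ.+ 2 ℕ.^ i)
        ≡⟨ cong (2# *_) (trans (^-assocʳ ξ j e) (trans (cong (ξ ^_) (ℕ.*-comm j e)) (sym (^-assocʳ ξ e j)))) ⟩
      2# * ratio i ^ j ∎
      where e = m ∸ 1 ℕ.+ 2 ℕ.^ i
    expand : ∀ j → (ξ ^ j) ^ (m ∸ 1) * (2# * trace (ξ ^ j)) ≡ ∑[ upTo (suc n′) ] (λ i → 2# * ratio i ^ j)
    expand j = begin
      (ξ ^ j) ^ (m ∸ 1) * (2# * trace (ξ ^ j))
        ≡⟨ cong ((ξ ^ j) ^ (m ∸ 1) *_) (∑R.∑-distrib-* 2# (λ i → σ^ i (ξ ^ j)) (upTo (suc n′))) ⟨
      (ξ ^ j) ^ (m ∸ 1) * ∑[ upTo (suc n′) ] (λ i → 2# * σ^ i (ξ ^ j))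
        ≡⟨ ∑R.∑-distrib-* ((ξ ^ j) ^ (m ∸ 1)) (λ i → 2# * σ^ i (ξ ^ j)) (upTo (suc n′)) ⟨
      ∑[ upTo (suc n′) ] (λ i → (ξ ^ j) ^ (m ∸ 1) * (2# * σ^ i (ξ ^ j)))
        ≡⟨ ∑R.∑-cong (upTo (suc n′)) (λ {i} _ → term j i) ⟩
      ∑[ upTo (suc n′) ] (λ i → 2# * ratio i ^ j) ∎

  -- m is odd: with m + 1 = 2N, the equation 2m = 0 would give 2 = 2(m + 1) = 4N = 0.
  2*m≢0 : 2# * (m · 1#) ≢ 0#
  2*m≢0 eq = 2≢0 (begin
    2#                                ≡⟨ solve 0 (con 2 := con 2 :* con 1 :+ con 0) refl ⟩
    2# * 1# + 0#                      ≡⟨ cong (2# * 1# +_) eq ⟨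
    2# * 1# + 2# * (m · 1#)           ≡⟨ distribˡ 2# 1# (m · 1#) ⟨
    2# * (suc m · 1#)                 ≡⟨ cong (λ k → 2# * (k · 1#)) suc-m ⟩
    2# * ((2 ℕ.* N) · 1#)             ≡⟨ cong (2# *_) (×1-homo-* 2 N) ⟩
    2# * ((2 · 1#) * (N · 1#))        ≡⟨ solve 1 (λ x → con 2 :* ((con 1 :+ (con 1 :+ con 0)) :* x) := con 0) refl (N · 1#) ⟩
    0#                                ∎)

  2*trace≢0 : ∃[ u ] (T u × 2# * trace u ≢ 0#)
  2*trace≢0 = decidable-stable (any? (λ u → T? u ×-dec ¬? (2# * trace u ≟ 0#))) λ none →
    2*m≢0 (trans (sym ξ^-trace-sum) (∑R.∑-zero _ (allFin m) λ {j} _ →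
      trans (cong ((ξ ^ toℕ j) ^ (m ∸ 1) *_)
              (decidable-stable (2# * trace (ξ ^ toℕ j) ≟ 0#) (λ ≢0 → none (ξ ^ toℕ j , T-ξ^ (toℕ j) , ≢0))))
            (zeroʳ _)))

  -- The additive characters

  ·1≡0⇒𝕚^≡1 : ∀ k → k · 1# ≡ 0# → 𝕚 ^ᴳ k ≡ 1ᴳ
  ·1≡0⇒𝕚^≡1 0 eq = refl
  ·1≡0⇒𝕚^≡1 1 eq = ⊥-elim (1≢0 (trans (solve 0 (con 1 := con 1 :+ con 0) refl) eq))
  ·1≡0⇒𝕚^≡1 2 eq = ⊥-elim (2≢0 (trans (solve 0 (con 2 := con 1 :+ (con 1 :+ con 0)) refl) eq))
  ·1≡0⇒𝕚^≡1 3 eq = ⊥-elim (2≢0 (trans (solve 0 (con 2 := con 2 :* (con 1 :+ (con 1 :+ (con 1 :+ con 0)))) refl)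
                            (trans (cong (2# *_) eq) (zeroʳ 2#))))
  ·1≡0⇒𝕚^≡1 (suc (suc (suc (suc k)))) eq =
    trans (𝕚^4+ k) (·1≡0⇒𝕚^≡1 k (trans (sym (4·1+ (k · 1#))) eq))

  𝕚^≡1⇒·1≡0 : ∀ k → 𝕚 ^ᴳ k ≡ 1ᴳ → k · 1# ≡ 0#
  𝕚^≡1⇒·1≡0 0 eq = refl
  𝕚^≡1⇒·1≡0 (suc (suc (suc (suc k)))) eq =
    trans (4·1+ (k · 1#)) (𝕚^≡1⇒·1≡0 k (trans (sym (𝕚^4+ k)) eq))

  ·1≡⇒𝕚^≡ : ∀ k l → k · 1# ≡ l · 1# → 𝕚 ^ᴳ k ≡ 𝕚 ^ᴳ l
  ·1≡⇒𝕚^≡ k l eq = begin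
    𝕚 ^ᴳ k                              ≡⟨ *ᴳ-identityʳ _ ⟨
    (𝕚 ^ᴳ k) *ᴳ 1ᴳ                      ≡⟨ cong ((𝕚 ^ᴳ k) *ᴳ_) (·1≡0⇒𝕚^≡1 (l′ ℕ.+ l) l′+l) ⟨
    (𝕚 ^ᴳ k) *ᴳ (𝕚 ^ᴳ (l′ ℕ.+ l))       ≡⟨ ^ᴳ-homo-+ 𝕚 k (l′ ℕ.+ l) ⟨
    𝕚 ^ᴳ (k ℕ.+ (l′ ℕ.+ l))             ≡⟨ cong (𝕚 ^ᴳ_) (ℕ.+-assoc k l′ l) ⟨
    𝕚 ^ᴳ (k ℕ.+ l′ ℕ.+ l)               ≡⟨ ^ᴳ-homo-+ 𝕚 (k ℕ.+ l′) l ⟩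
    (𝕚 ^ᴳ (k ℕ.+ l′)) *ᴳ (𝕚 ^ᴳ l)       ≡⟨ cong (_*ᴳ (𝕚 ^ᴳ l)) (·1≡0⇒𝕚^≡1 (k ℕ.+ l′) k+l′) ⟩
    1ᴳ *ᴳ (𝕚 ^ᴳ l)                      ≡⟨ *ᴳ-identityˡ _ ⟩
    𝕚 ^ᴳ l                              ∎
    where
    l′ = 3 ℕ.* l
    l′+l : (l′ ℕ.+ l) · 1# ≡ 0#
    l′+l = trans (×-homo-+ 1# l′ l) (trans (cong (_+ l · 1#) (×1-homo-* 3 l))
      (solve 1 (λ x → (con 1 :+ (con 1 :+ (con 1 :+ con 0))) :* x :+ x := con 0) refl (l · 1#)))
    k+l′ : (k ℕ.+ l′) · 1# ≡ 0#
    k+l′ = trans (×-homo-+ 1# k l′) (trans (cong (_+ l′ · 1#) eq)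
      (trans (+-comm _ _) (trans (sym (×-homo-+ 1# l′ l)) l′+l)))

  ψ : Carrier → ℤ[i]
  ψ x = 𝕚 ^ᴳ Tr x

  ψ-+ : ∀ x y → ψ (x + y) ≡ ψ x *ᴳ ψ y
  ψ-+ x y = trans (·1≡⇒𝕚^≡ (Tr (x + y)) (Tr x ℕ.+ Tr y) (begin
      Tr (x + y) · 1#              ≡⟨ trace≡Tr (x + y) ⟨
      trace (x + y)                ≡⟨ trace-+ x y ⟩
      trace x + trace y            ≡⟨ cong₂ _+_ (trace≡Tr x) (trace≡Tr y) ⟩
      Tr x · 1# + Tr y · 1#        ≡⟨ ×-homo-+ 1# (Tr x) (Tr y) ⟨
      (Tr x ℕ.+ Tr y) · 1#         ∎))
    (^ᴳ-homo-+ 𝕚 (Tr x) (Tr y))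

  ψ≡1⇒trace≡0 : ∀ x → ψ x ≡ 1ᴳ → trace x ≡ 0#
  ψ≡1⇒trace≡0 x eq = trans (trace≡Tr x) (𝕚^≡1⇒·1≡0 (Tr x) eq)

  ψ-0 : ψ 0# ≡ 1ᴳ
  ψ-0 = ·1≡0⇒𝕚^≡1 (Tr 0#) (trans (sym (trace≡Tr 0#)) (+-cancelʳ _ _ (trace 0#)
    (trans (sym (trace-+ 0# 0#)) (trans (cong trace (+-identityˡ 0#)) (sym (+-identityˡ _))))))

  ψ-neg : ∀ x → ψ (- x) ≡ conj (ψ x)
  ψ-neg x = begin
    ψ (- x)                             ≡⟨ *ᴳ-identityˡ _ ⟨
    1ᴳ *ᴳ ψ (- x)                       ≡⟨ cong (_*ᴳ ψ (- x)) (trans (*ᴳ-comm _ (ψ x)) (*ᴳ-conj-𝕚^ (Tr x))) ⟨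
    conj (ψ x) *ᴳ ψ x *ᴳ ψ (- x)        ≡⟨ *ᴳ-assoc (conj (ψ x)) (ψ x) (ψ (- x)) ⟩
    conj (ψ x) *ᴳ (ψ x *ᴳ ψ (- x))      ≡⟨ cong (conj (ψ x) *ᴳ_) (trans (sym (ψ-+ x (- x))) (trans (cong ψ (-‿inverseʳ x)) ψ-0)) ⟩
    conj (ψ x) *ᴳ 1ᴳ                    ≡⟨ *ᴳ-identityʳ _ ⟩
    conj (ψ x)                          ∎

  unit-inverse : ∀ {x} → 2# * x ≢ 0# → ∃[ y ] x * y ≡ 1#
  unit-inverse {x} 2x≢0 = lift (T-nonzero-inverse (^q∈T x) x^q≢0)
    where
    x^q≢0 : x ^ q ≢ 0#
    x^q≢0 eq = 2x≢0 (trans (sym (^q≡₂ x)) (trans (cong (2# *_) eq) (zeroʳ 2#)))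
    lift : ∃[ b ] x ^ q * b ≡ 1# → ∃[ y ] x * y ≡ 1#
    lift (b , eq) = x ^ m * b , trans (sym (*-assoc x (x ^ m) b)) (trans (cong (λ k → x ^ k * b) suc-m) eq)

  trace-2* : ∀ x → trace (2# * x) ≡ 2# * trace x
  trace-2* x = trans (cong trace (solve 1 (λ x → con 2 :* x := x :+ x) refl x))
    (trans (trace-+ x x) (solve 1 (λ x → x :+ x := con 2 :* x) refl (trace x)))

  -- Multiplication by the inverse of x makes 2(u x) twice an element of odd trace, and there ψ
  -- differs from 1.
  nondegenerate-unit : ∀ {x} → 2# * x ≢ 0# → ∃[ u ] ψ (2# * (u * x)) ≢ 1ᴳ
  nondegenerate-unit {x} 2x≢0 = lift 2*trace≢0 (unit-inverse 2x≢0)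
    where
    lift : ∃[ u ] (T u × 2# * trace u ≢ 0#) → ∃[ y ] x * y ≡ 1# → ∃[ u ] ψ (2# * (u * x)) ≢ 1ᴳ
    lift (u , Tu , 2Tr≢0) (y , xy≡1) = u * y , λ eq →
      2Tr≢0 (trans (sym (trace-2* u)) (trans (cong (λ s → trace (2# * s)) (begin
        u             ≡⟨ *-identityʳ u ⟨
        u * 1#        ≡⟨ cong (u *_) xy≡1 ⟨
        u * (x * y)   ≡⟨ solve 3 (λ u x y → u :* (x :* y) := u :* y :* x) refl u x y ⟩
        u * y * x     ∎)) (ψ≡1⇒trace≡0 _ eq)))

  -- A nonzero x is either a unit or 2y with y a unit. In the first case the multiplier brings the
  -- factor 2, in the second x already contains it.
  nondegenerate : ∀ {x} → x ≢ 0# → ∃[ u ] ψ (u * x) ≢ 1ᴳ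
  nondegenerate {x} x≢0 with 2# * x ≟ 0#
  ... | no 2x≢0  = let u , ≢1 = nondegenerate-unit 2x≢0 in
                   2# * u , λ eq → ≢1 (trans (cong ψ (sym (*-assoc 2# u x))) eq)
  ... | yes 2x≡0 = lift (2*≡0⇒∃ 2x≡0)
    where
    lift : ∃[ y ] x ≡ 2# * y → ∃[ u ] ψ (u * x) ≢ 1ᴳ
    lift (y , x≡2y) = let u , ≢1 = nondegenerate-unit (λ 2y≡0 → x≢0 (trans x≡2y 2y≡0)) in
      u , λ eq → ≢1 (trans (cong ψ (trans (solve 2 (λ u y → con 2 :* (u :* y) := u :* (con 2 :* y)) refl u y)
                                          (cong (u *_) (sym x≡2y)))) eq)

  χ-injective : ∀ {a b} → (∀ x → χ a x ≡ χ b x) → a ≡ b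
  χ-injective {a} {b} eq = decidable-stable (a ≟ b) λ a≢b →
    let u , ≢1 = nondegenerate (λ a-b≡0 → a≢b (+-cancelʳ a b (- b) (trans a-b≡0 (sym (-‿inverseʳ b)))))
    in ≢1 (begin
      ψ (u * (a + - b))          ≡⟨ cong ψ (solve 3 (λ u a b → u :* (a :+ :- b) := a :* u :+ :- (b :* u)) refl u a b) ⟩
      ψ (a * u + - (b * u))      ≡⟨ ψ-+ _ _ ⟩
      ψ (a * u) *ᴳ ψ (- (b * u)) ≡⟨ cong (_*ᴳ ψ (- (b * u))) (eq u) ⟩
      ψ (b * u) *ᴳ ψ (- (b * u)) ≡⟨ ψ-+ _ _ ⟨
      ψ (b * u + - (b * u))      ≡⟨ trans (cong ψ (-‿inverseʳ (b * u))) ψ-0 ⟩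
      1ᴳ                         ∎)

  -- Character sums

  -- The elements 2t with t ∈ T are those of 2R, each once, and t ↦ t ⊕ u^q is translation by 2u. It
  -- multiplies each term by ψ(2ua), which is not 1 for a suitable u.
  ∑-T-0 : ∀ {a} → 2# * a ≢ 0# → ∑ᴳ[ Ts ] (λ t → ψ (a * (2# * t))) ≡ 0ᴳ
  ∑-T-0 {a} 2a≢0 = translate (nondegenerate-unit 2a≢0)
    where
    translate : ∃[ u ] ψ (2# * (u * a)) ≢ 1ᴳ → ∑ᴳ[ Ts ] (λ t → ψ (a * (2# * t))) ≡ 0ᴳ
    translate (u , ≢1) = ∑ᴳ-semiinvariant≡0 _ (_⊕ u ^ q) (ψ (2# * (u * a)))
      (injective⇒map-↭ _ Ts-unique (λ t∈ → T⇒∈Ts (T-⊕ (∈Ts⇒T t∈) (^q∈T u)))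
        (λ s∈ t∈ → ⊕-cancelʳ (∈Ts⇒T s∈) (∈Ts⇒T t∈))) (λ {t} _ → scale t) ≢1
      where
      ⊕-cancelʳ : ∀ {s t} → T s → T t → s ⊕ u ^ q ≡ t ⊕ u ^ q → s ≡ t
      ⊕-cancelʳ {s} {t} Ts Tt eq = T-≡₂⇒≡ Ts Tt (+-cancelʳ _ _ (2# * u ^ q)
        (trans (sym (distribˡ 2# s (u ^ q))) (trans (sym (⊕≡₂ s (u ^ q)))
          (trans (cong (2# *_) eq) (trans (⊕≡₂ t (u ^ q)) (distribˡ 2# t (u ^ q)))))))
      scale : ∀ t → ψ (a * (2# * (t ⊕ u ^ q))) ≡ ψ (2# * (u * a)) *ᴳ ψ (a * (2# * t))
      scale t = trans (cong ψ (begin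
        a * (2# * (t ⊕ u ^ q))              ≡⟨ cong (a *_) (trans (⊕≡₂ t (u ^ q)) (distribˡ 2# t (u ^ q))) ⟩
        a * (2# * t + 2# * u ^ q)           ≡⟨ cong (λ s → a * (2# * t + s)) (^q≡₂ u) ⟩
        a * (2# * t + 2# * u)               ≡⟨ solve 3 (λ a t u → a :* (con 2 :* t :+ con 2 :* u) :=
                                                 con 2 :* (u :* a) :+ a :* (con 2 :* t)) refl a t u ⟩
        2# * (u * a) + a * (2# * t)         ∎)) (ψ-+ _ _)

  ∑-R-0 : ∀ {x} → x ≢ 0# → ∑ᴳ[ elements ] (λ a → ψ (a * x)) ≡ 0ᴳ
  ∑-R-0 {x} x≢0 = translate (nondegenerate x≢0)
    where
    translate : ∃[ u ] ψ (u * x) ≢ 1ᴳ → ∑ᴳ[ elements ] (λ a → ψ (a * x)) ≡ 0ᴳ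
    translate (u , ≢1) = ∑ᴳ-semiinvariant≡0 _ (_+ u) (ψ (u * x))
      (injective⇒map-↭ _ elements-unique (λ {a} _ → ∈-elements (a + u)) (λ _ _ → +-cancelʳ _ _ u))
      (λ {a} _ → trans (cong ψ (trans (distribʳ x a u) (+-comm _ _))) (ψ-+ _ _)) ≢1

  ∑-R : ∀ {x} → x ≡ 0# → ∑ᴳ[ elements ] (λ a → ψ (a * x)) ≡ ℤ.+ (q ℕ.* q) +i 0ℤ
  ∑-R refl = trans (∑ᴳ.∑-cong elements (λ {a} _ → trans (cong ψ (zeroʳ a)) ψ-0))
    (trans (∑ᴳ-const-1 elements) (cong (λ k → ℤ.+ k +i 0ℤ) length-elements))

  -- Modulo 2, √ is a power of the Frobenius map and hence additive. This suffices, since √ enters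
  -- `d` only as 2√.
  √-⊕ : ∀ x y → 2# * √ (x ⊕ y) ≡ 2# * (√ x + √ y)
  √-⊕ x y = trans (≡₂-^ (⊕≡₂ x y) N) (2*^2^-+ n′)
    where
    2*^2^-+ : ∀ k → 2# * (x + y) ^ (2 ℕ.^ k) ≡ 2# * (x ^ (2 ℕ.^ k) + y ^ (2 ℕ.^ k))
    2*^2^-+ zero    = solve 2 (λ x y → con 2 :* ((x :+ y) :* con 1) := con 2 :* (x :* con 1 :+ y :* con 1)) refl x y
    2*^2^-+ (suc k) = trans (cong (2# *_) (^2^-+ x y k)) (+2*≡₂ _ _)

  -- The character sums of a pseudo-planar function

  module Spectrum (f : Carrier → Carrier) (f-pseudoPlanar : PseudoPlanar f) (f-0 : f 0# ≡ 0#) where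

    d : Carrier → Carrier
    d t = t + 2# * √ (f t)

    X : Carrier → ℤ[i]
    X a = ∑ᴳ[ Ts ] (λ t → ψ (a * d t))

    -- Since d t ≡ t modulo 2, `d` is injective on T, so the sum over the set `D f` can be taken
    -- over T.
    filter-D-↭ : filter (D? f) elements ↭ map d Ts
    filter-D-↭ = unique-≋-↭ (Unique.filter⁺ (D? f) elements-unique)
      (unique-map d (λ s∈ t∈ eq → T-≡₂⇒≡ (∈Ts⇒T s∈) (∈Ts⇒T t∈)
        (trans (sym (+2*≡₂ _ _)) (trans (cong (2# *_) eq) (+2*≡₂ _ _)))) Ts-unique)
      (λ x∈ → into (proj₂ (∈-filter⁻ (D? f) {xs = elements} x∈)))
      (λ x∈ → back (∈-map⁻ d x∈))
      where
      into : ∀ {x} → D f x → x ∈ map d Ts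
      into (t , Tt , refl) = ∈-map⁺ d (T⇒∈Ts Tt)
      back : ∀ {x} → ∃[ t ] (t ∈ Ts × x ≡ d t) → x ∈ filter (D? f) elements
      back {x} (t , t∈ , x≡) = ∈-filter⁺ (D? f) (∈-elements x) (t , ∈Ts⇒T t∈ , x≡)

    ∑-D≡X : ∀ a → ∑ (χ a) (D? f) ≡ X a
    ∑-D≡X a = trans (∑ᴳ.∑-↭ (χ a) filter-D-↭) (∑ᴳ.∑-map (χ a) d Ts)

    fourierSpectrum≡ : fourierSpectrum f ≡ map X elements
    fourierSpectrum≡ = trans
      (cong (map (λ φ → ∑ φ (D? f))) (deduplicate-distinct (λ φ ρ → all? (λ x → φ x ≟ᴳ ρ x))
        (AllPairs.map⁺ (AllPairs.map (λ a≢b χa≗χb → a≢b (χ-injective χa≗χb)) elements-unique))))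
      (trans (sym (map-∘ elements)) (map-cong ∑-D≡X elements))

    -- Since d is injective modulo 2, d s + d t = 0 forces s = t and then 2 s = 0.

    d-0 : d 0# ≡ 0#
    d-0 = trans (cong (λ s → 0# + 2# * s) (trans (cong √_ f-0) (0^2^ n′)))
            (solve 0 (con 0 :+ con 2 :* con 0 := con 0) refl)

    2*T*≢0 : ∀ {t} → t ∈ T*s → 2# * t ≢ 0#
    2*T*≢0 t∈ 2t≡0 = T*s≢0 t∈ (T-≡₂⇒≡ (∈Ts⇒T (there t∈)) T-0 (trans 2t≡0 (sym (zeroʳ 2#))))

    d≢0 : ∀ {t} → t ∈ T*s → d t ≢ 0#
    d≢0 {t} t∈ dt≡0 = 2*T*≢0 t∈ (trans (sym (+2*≡₂ t _)) (trans (cong (2# *_) dt≡0) (zeroʳ 2#)))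

    d+d≢0 : ∀ {s t} → s ∈ T*s → t ∈ Ts → d s + d t ≢ 0#
    d+d≢0 {s} {t} s∈ t∈ eq = 2*T*≢0 s∈ (begin
        2# * s            ≡⟨ solve 2 (λ s r → con 2 :* s := (s :+ con 2 :* r) :+ (s :+ con 2 :* r)) refl s (√ (f s)) ⟩
        d s + d s         ≡⟨ cong (λ x → d s + d x) s≡t ⟩
        d s + d t         ≡⟨ eq ⟩
        0#                ∎)
      where
      s≡t : s ≡ t
      s≡t = T-≡₂⇒≡ (∈Ts⇒T (there s∈)) (∈Ts⇒T t∈) (begin
        2# * s                   ≡⟨ solve 4 (λ s r t r′ → con 2 :* s :=
                                      con 2 :* ((s :+ con 2 :* r) :+ (t :+ con 2 :* r′)) :+ con 2 :* t) refl s (√ (f s)) t (√ (f t)) ⟩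
        2# * (d s + d t) + 2# * t ≡⟨ cong (λ x → 2# * x + 2# * t) eq ⟩
        2# * 0# + 2# * t         ≡⟨ solve 1 (λ t → con 2 :* con 0 :+ con 2 :* t := con 2 :* t) refl t ⟩
        2# * t                   ∎)

    -- Summing over a first leaves q² for each t with d t = 0. As d t ≡ t modulo 2, only t = 0 can
    -- qualify, and it does because `f 0# ≡ 0#`.
    ∑X : ∑ᴳ[ elements ] X ≡ ℤ.+ (q ℕ.* q) +i 0ℤ
    ∑X = begin
      ∑ᴳ[ elements ] X                                     ≡⟨ ∑ᴳ.∑-swap _ elements Ts ⟩
      ∑ᴳ[ Ts ] (λ t → ∑ᴳ[ elements ] (λ a → ψ (a * d t)))   ≡⟨ cong₂ _+ᴳ_ (∑-R d-0) (∑ᴳ.∑-zero _ T*s (λ t∈ → ∑-R-0 (d≢0 t∈))) ⟩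
      (ℤ.+ (q ℕ.* q) +i 0ℤ) +ᴳ 0ᴳ                          ≡⟨ +ᴳ-identityʳ _ ⟩
      ℤ.+ (q ℕ.* q) +i 0ℤ                                  ∎

    -- The same count for pairs: q² for each (s , t) with d s + d t = 0. A conjugated factor would
    -- lead to d s - d t and to the sum of the norms, which are known anyway.
    ∑X² : ∑ᴳ[ elements ] (λ a → X a *ᴳ X a) ≡ ℤ.+ (q ℕ.* q) +i 0ℤ
    ∑X² = begin
      ∑ᴳ[ elements ] (λ a → X a *ᴳ X a)
        ≡⟨ ∑ᴳ.∑-cong elements (λ {a} _ → trans (∑ᴳ.∑-* (λ s → ψ (a * d s)) (λ t → ψ (a * d t)) Ts Ts)
             (∑ᴳ.∑-cong Ts (λ {s} _ → ∑ᴳ.∑-cong Ts (λ {t} _ → product a s t)))) ⟩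
      ∑ᴳ[ elements ] (λ a → ∑ᴳ[ Ts ] (λ s → ∑ᴳ[ Ts ] (λ t → ψ (a * (d s + d t)))))
        ≡⟨ ∑ᴳ.∑-swap _ elements Ts ⟩
      ∑ᴳ[ Ts ] (λ s → ∑ᴳ[ elements ] (λ a → ∑ᴳ[ Ts ] (λ t → ψ (a * (d s + d t)))))
        ≡⟨ ∑ᴳ.∑-cong Ts (λ _ → ∑ᴳ.∑-swap _ elements Ts) ⟩
      ∑ᴳ[ Ts ] (λ s → ∑ᴳ[ Ts ] (λ t → ∑ᴳ[ elements ] (λ a → ψ (a * (d s + d t)))))
        ≡⟨ cong₂ _+ᴳ_
             (cong₂ _+ᴳ_ (∑-R (trans (cong₂ _+_ d-0 d-0) (+-identityˡ 0#)))
                         (∑ᴳ.∑-zero _ T*s (λ t∈ → ∑-R-0 (λ eq → d≢0 t∈ (trans (sym (trans (cong (_+ d _) d-0) (+-identityˡ _))) eq)))))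
             (∑ᴳ.∑-zero _ T*s (λ s∈ → ∑ᴳ.∑-zero _ Ts (λ t∈ → ∑-R-0 (d+d≢0 s∈ t∈)))) ⟩
      ((ℤ.+ (q ℕ.* q) +i 0ℤ) +ᴳ 0ᴳ) +ᴳ 0ᴳ
        ≡⟨ trans (+ᴳ-identityʳ _) (+ᴳ-identityʳ _) ⟩
      ℤ.+ (q ℕ.* q) +i 0ℤ ∎
      where
      product : ∀ a s t → ψ (a * d s) *ᴳ ψ (a * d t) ≡ ψ (a * (d s + d t))
      product a s t = trans (sym (ψ-+ (a * d s) (a * d t))) (cong ψ (sym (distribˡ a (d s) (d t))))

    X-0 : X (0# + 2# * 0#) ≡ ℤ.+ q +i 0ℤ
    X-0 = trans (∑ᴳ.∑-cong Ts (λ {t} _ → trans (cong ψ (solve 1 (λ x → (con 0 :+ con 2 :* con 0) :* x := con 0) refl (d t))) ψ-0))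
            (trans (∑ᴳ-const-1 Ts) (cong (λ k → ℤ.+ k +i 0ℤ) length-Ts))

    -- For a = 2c the product a (t + 2r) is 2ct, because 4 = 0; the values of f disappear and the
    -- sum is one over 2R.
    X-2T : ∀ {c} → c ∈ T*s → X (0# + 2# * c) ≡ 0ᴳ
    X-2T {c} c∈ = trans (∑ᴳ.∑-cong Ts (λ {t} _ → cong ψ
        (solve 3 (λ c t r → (con 0 :+ con 2 :* c) :* (t :+ con 2 :* r) := c :* (con 2 :* t)) refl c t (√ (f t)))))
      (∑-T-0 (2*T*≢0 c∈))

    -- The substitution s = t ⊕ ε turns d s - d t into ε + 2 √(g t), where g = f(· ⊕ ε) ⊕ f ⊕ ε · permutes T.

    module _ {a : Carrier} (2a≢0 : 2# * a ≢ 0#) where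

      ∑-differences : ∀ {ε} → ε ∈ T*s → ∑ᴳ[ Ts ] (λ t → ψ (a * (d (t ⊕ ε) + - d t))) ≡ 0ᴳ
      ∑-differences {ε} ε∈ = begin
        ∑ᴳ[ Ts ] (λ t → ψ (a * (d (t ⊕ ε) + - d t)))
          ≡⟨ ∑ᴳ.∑-cong Ts (λ {t} _ → trans (cong ψ (difference t)) (ψ-+ _ _)) ⟩
        ∑ᴳ[ Ts ] (λ t → ψ (a * ε) *ᴳ ψ (a * (2# * √ (g t))))
          ≡⟨ ∑ᴳ.∑-distrib-* (ψ (a * ε)) _ Ts ⟩
        ψ (a * ε) *ᴳ ∑ᴳ[ Ts ] (λ t → ψ (a * (2# * √ (g t))))
          ≡⟨ cong (ψ (a * ε) *ᴳ_) (trans (sym (∑ᴳ.∑-map (λ t → ψ (a * (2# * t))) (λ t → √ (g t)) Ts))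
                                  (trans (∑ᴳ.∑-↭ (λ t → ψ (a * (2# * t))) √g-↭) (∑-T-0 2a≢0))) ⟩
        ψ (a * ε) *ᴳ 0ᴳ
          ≡⟨ *ᴳ-zeroʳ (ψ (a * ε)) ⟩
        0ᴳ ∎
        where
        g : Carrier → Carrier
        g t = f (t ⊕ ε) ⊕ f t ⊕ ε * t
        Tε : T ε
        Tε = ∈Ts⇒T (there ε∈)
        g-permutes : PermutesT g
        g-permutes = proj₂ f-pseudoPlanar ε Tε (T*s≢0 ε∈)
        T-g : ∀ {t} → T t → T (g t)
        T-g = proj₁ g-permutes
        √g-↭ : map (λ t → √ (g t)) Ts ↭ Ts
        √g-↭ = injective⇒map-↭ _ Ts-unique (λ t∈ → T⇒∈Ts (T-√ (T-g (∈Ts⇒T t∈))))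
          (λ s∈ t∈ eq → proj₁ (proj₂ g-permutes) (∈Ts⇒T s∈) (∈Ts⇒T t∈)
            (trans (sym (√-square (T-g (∈Ts⇒T s∈)))) (trans (cong (λ x → x * x) eq) (√-square (T-g (∈Ts⇒T t∈))))))
        2√g : ∀ t → 2# * √ (g t) ≡ 2# * √ (f (t ⊕ ε)) + 2# * √ (f t) + 2# * √ (t * ε)
        2√g t = begin
          2# * √ (g t)
            ≡⟨ trans (√-⊕ (f (t ⊕ ε) ⊕ f t) (ε * t)) (distribˡ 2# _ _) ⟩
          2# * √ (f (t ⊕ ε) ⊕ f t) + 2# * √ (ε * t)
            ≡⟨ cong₂ _+_ (trans (√-⊕ (f (t ⊕ ε)) (f t)) (distribˡ 2# _ _)) (cong (λ x → 2# * √ x) (*-comm ε t)) ⟩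
          2# * √ (f (t ⊕ ε)) + 2# * √ (f t) + 2# * √ (t * ε) ∎
        difference : ∀ t → a * (d (t ⊕ ε) + - d t) ≡ a * ε + a * (2# * √ (g t))
        difference t = begin
          a * (d (t ⊕ ε) + - d t)
            -- The carry 2√(tε) of t ⊕ ε supplies the summand εt of `g`, and -2v = 2v turns the
            -- difference of the values of f into a sum.
            ≡⟨ solve 6 (λ a t ε r u v → a :* ((t :+ ε :+ con 2 :* r) :+ con 2 :* u :+ :- (t :+ con 2 :* v)) :=
                 a :* ε :+ a :* (con 2 :* u :+ con 2 :* v :+ con 2 :* r)) refl a t ε (√ (t * ε)) (√ (f (t ⊕ ε))) (√ (f t)) ⟩
          a * ε + a * (2# * √ (f (t ⊕ ε)) + 2# * √ (f t) + 2# * √ (t * ε))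
            ≡⟨ cong (λ x → a * ε + a * x) (2√g t) ⟨
          a * ε + a * (2# * √ (g t)) ∎

      ⊕-↭ : ∀ {t} → T t → map (t ⊕_) Ts ↭ Ts
      ⊕-↭ {t} Tt = injective⇒map-↭ _ Ts-unique (λ ε∈ → T⇒∈Ts (T-⊕ Tt (∈Ts⇒T ε∈)))
        (λ {x} {y} x∈ y∈ eq → T-≡₂⇒≡ (∈Ts⇒T x∈) (∈Ts⇒T y∈) (+-cancelʳ _ _ (2# * t) (begin
          2# * x + 2# * t ≡⟨ solve 2 (λ x t → con 2 :* x :+ con 2 :* t := con 2 :* (t :+ x)) refl x t ⟩
          2# * (t + x)    ≡⟨ trans (sym (⊕≡₂ t x)) (trans (cong (2# *_) eq) (⊕≡₂ t y)) ⟩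
          2# * (t + y)    ≡⟨ solve 2 (λ x t → con 2 :* (t :+ x) := con 2 :* x :+ con 2 :* t) refl y t ⟩
          2# * y + 2# * t ∎)))

      ⊕-0 : ∀ t → t ⊕ 0# ≡ t
      ⊕-0 t = trans (cong (λ x → t + 0# + 2# * x) (trans (cong √_ (zeroʳ t)) (0^2^ n′)))
                (solve 1 (λ t → t :+ con 0 :+ con 2 :* con 0 := t) refl t)

      X-conj : X a *ᴳ conj (X a) ≡ ℤ.+ q +i 0ℤ
      X-conj = begin
        X a *ᴳ conj (X a)
          ≡⟨ *ᴳ-comm (X a) (conj (X a)) ⟩
        conj (X a) *ᴳ X a
          ≡⟨ cong (_*ᴳ X a) (trans (conj-∑ (λ t → ψ (a * d t)) Ts) (∑ᴳ.∑-cong Ts (λ {t} _ → sym (ψ-neg (a * d t))))) ⟩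
        ∑ᴳ[ Ts ] (λ t → ψ (- (a * d t))) *ᴳ X a
          ≡⟨ ∑ᴳ.∑-* (λ t → ψ (- (a * d t))) (λ s → ψ (a * d s)) Ts Ts ⟩
        ∑ᴳ[ Ts ] (λ t → ∑ᴳ[ Ts ] (λ s → ψ (- (a * d t)) *ᴳ ψ (a * d s)))
          ≡⟨ ∑ᴳ.∑-cong Ts (λ {t} _ → ∑ᴳ.∑-cong Ts (λ {s} _ → trans (sym (ψ-+ _ _))
               (cong ψ (solve 3 (λ a x y → :- (a :* x) :+ a :* y := a :* (y :+ :- x)) refl a (d t) (d s))))) ⟩
        ∑ᴳ[ Ts ] (λ t → ∑ᴳ[ Ts ] (λ s → ψ (a * (d s + - d t))))
          ≡⟨ ∑ᴳ.∑-cong Ts (λ {t} t∈ → reindex t (∈Ts⇒T t∈)) ⟩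
        ∑ᴳ[ Ts ] (λ t → ∑ᴳ[ Ts ] (λ ε → ψ (a * (d (t ⊕ ε) + - d t))))
          ≡⟨ ∑ᴳ.∑-swap (λ t ε → ψ (a * (d (t ⊕ ε) + - d t))) Ts Ts ⟩
        ∑ᴳ[ Ts ] (λ ε → ∑ᴳ[ Ts ] (λ t → ψ (a * (d (t ⊕ ε) + - d t))))
          ≡⟨ cong₂ _+ᴳ_
               (trans (∑ᴳ.∑-cong Ts (λ {t} _ → trans (cong ψ (trans (cong (λ x → a * (d x + - d t)) (⊕-0 t))
                        (trans (cong (a *_) (-‿inverseʳ (d t))) (zeroʳ a)))) ψ-0))
                      (trans (∑ᴳ-const-1 Ts) (cong (λ k → ℤ.+ k +i 0ℤ) length-Ts)))
               (∑ᴳ.∑-zero _ T*s ∑-differences) ⟩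
        (ℤ.+ q +i 0ℤ) +ᴳ 0ᴳ
          ≡⟨ +ᴳ-identityʳ _ ⟩
        ℤ.+ q +i 0ℤ ∎
        where
        reindex : ∀ t → T t → ∑ᴳ[ Ts ] (λ s → ψ (a * (d s + - d t))) ≡ ∑ᴳ[ Ts ] (λ ε → ψ (a * (d (t ⊕ ε) + - d t)))
        reindex t Tt = trans (sym (∑ᴳ.∑-↭ φ (⊕-↭ Tt))) (∑ᴳ.∑-map φ (t ⊕_) Ts)
          where
          φ : Carrier → ℤ[i]
          φ s = ψ (a * (d s + - d t))

    -- These are the values at a = b + 2c with b ∈ T nonzero, the units of R; the remaining a form
    -- 2R.
    regular : List ℤ[i]
    regular = map (X ∘ rep) (cartesianProduct T*s Ts)

    fourierSpectrum-↭ : fourierSpectrum f ↭ (ℤ.+ q +i 0ℤ) ∷ replicate m 0ᴳ ++ regular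
    fourierSpectrum-↭ = ↭-trans (↭-reflexive fourierSpectrum≡)
      (↭-trans (map⁺ X (↭-sym pairs↭elements))
      -- `pairs` begins with (0 , 0); then come the (0 , c) with c ≠ 0, then the pairs for the
      -- units.
      (↭-reflexive (trans (sym (map-∘ pairs)) (cong₂ _∷_ X-0
        (trans (map-++ (X ∘ rep) (map (0# ,_) T*s) (cartesianProduct T*s Ts))
          (cong (_++ regular) zeros))))))
      where
      map-const : ∀ {a b} {A : Set a} {B : Set b} (h : A → B) {y} xs → (∀ {x} → x ∈ xs → h x ≡ y) →
                  map h xs ≡ replicate (length xs) y
      map-const h []       eq = refl
      map-const h (x ∷ xs) eq = cong₂ _∷_ (eq (here refl)) (map-const h xs (eq ∘ there))
      zeros : map (X ∘ rep) (map (0# ,_) T*s) ≡ replicate m 0ᴳ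
      zeros = trans (sym (map-∘ T*s)) (trans (map-const _ T*s X-2T)
        (cong (λ k → replicate k 0ᴳ) (trans (length-map _ (allFin m)) (length-tabulate {n = m} id))))

    length-regular : length regular ≡ m ℕ.* q
    length-regular = trans (length-map (X ∘ rep) (cartesianProduct T*s Ts))
      (trans (length-cartesianProduct T*s Ts)
        (cong₂ ℕ._*_ (trans (length-map _ (allFin m)) (length-tabulate {n = m} id)) length-Ts))

    norm-regular : ∀ {z} → z ∈ regular → normᴳ z ≡ ℤ.+ q
    norm-regular z∈ = unpack (∈-map⁻ (X ∘ rep) z∈)
      where
      unpack : ∀ {z} → ∃[ p ] (p ∈ cartesianProduct T*s Ts × z ≡ X (rep p)) → normᴳ z ≡ ℤ.+ q
      unpack {z} ((a , b) , p∈ , refl) = cong re (trans (sym (*ᴳ-conj (X (a + 2# * b)))) (X-conj (λ eq →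
        2*T*≢0 (proj₁ (∈-cartesianProduct⁻ T*s Ts p∈)) (trans (sym (+2*≡₂ a b)) eq))))

    -- The m zeros drop out as `h 0ᴳ ≡ 0ᴳ`, which turns a moment over R into an equation about the
    -- unknown values only.
    moment : (h : ℤ[i] → ℤ[i]) → h 0ᴳ ≡ 0ᴳ →
             h (ℤ.+ q +i 0ℤ) +ᴳ ∑ᴳ[ regular ] h ≡ ∑ᴳ[ elements ] (h ∘ X)
    moment h h-0 = begin
      h (ℤ.+ q +i 0ℤ) +ᴳ ∑ᴳ[ regular ] h
        ≡⟨ cong (h (ℤ.+ q +i 0ℤ) +ᴳ_) (trans (sym (+ᴳ-identityˡ _))
             (cong (_+ᴳ ∑ᴳ[ regular ] h) (sym (∑ᴳ.∑-zero h (replicate m 0ᴳ) (λ z∈ → trans (cong h (replicate-∈ m z∈)) h-0))))) ⟩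
      h (ℤ.+ q +i 0ℤ) +ᴳ (∑ᴳ[ replicate m 0ᴳ ] h +ᴳ ∑ᴳ[ regular ] h)
        ≡⟨ cong (h (ℤ.+ q +i 0ℤ) +ᴳ_) (∑ᴳ.∑-++ h (replicate m 0ᴳ) regular) ⟨
      ∑ᴳ[ (ℤ.+ q +i 0ℤ) ∷ replicate m 0ᴳ ++ regular ] h
        ≡⟨ ∑ᴳ.∑-↭ h fourierSpectrum-↭ ⟨
      ∑ᴳ[ fourierSpectrum f ] h
        ≡⟨ cong (λ l → ∑ᴳ[ l ] h) fourierSpectrum≡ ⟩
      ∑ᴳ[ map X elements ] h
        ≡⟨ ∑ᴳ.∑-map h X elements ⟩
      ∑ᴳ[ elements ] (h ∘ X) ∎
      where
      replicate-∈ : ∀ k {z} → z ∈ replicate k 0ᴳ → z ≡ 0ᴳ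
      replicate-∈ (suc k) (here z≡)  = z≡
      replicate-∈ (suc k) (there z∈) = replicate-∈ k z∈

open import Data.Integer.Base using (+_)

-- Sums of two squares that are powers of 2

data Parity : ℕ → Set where
  even : ∀ k → Parity (2 ℕ.* k)
  odd  : ∀ k → Parity (1 ℕ.+ 2 ℕ.* k)

parity : ∀ n → Parity n
parity zero = even 0
parity (suc n) with parity n
... | even k = odd k
... | odd k  = subst Parity (cong suc (ℕ.+-suc k (k ℕ.+ 0))) (even (suc k))

residue≢ : ∀ r k l → suc r ℕ.< 4 → suc r ℕ.+ 4 ℕ.* k ≢ 4 ℕ.* l
residue≢ r k l r<4 eq with begin
    suc r                       ≡⟨ ℕ.m<n⇒m%n≡m r<4 ⟨
    suc r ℕ.% 4                 ≡⟨ ℕ.[m+kn]%n≡m%n (suc r) k 4 ⟨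
    (suc r ℕ.+ k ℕ.* 4) ℕ.% 4   ≡⟨ cong (λ t → (suc r ℕ.+ t) ℕ.% 4) (ℕ.*-comm k 4) ⟩
    (suc r ℕ.+ 4 ℕ.* k) ℕ.% 4   ≡⟨ cong (ℕ._% 4) eq ⟩
    (4 ℕ.* l) ℕ.% 4             ≡⟨ cong (ℕ._% 4) (ℕ.*-comm 4 l) ⟩
    (l ℕ.* 4) ℕ.% 4             ≡⟨ ℕ.m*n%n≡0 l 4 ⟩
    0                           ∎
  where open ≡-Reasoning
... | ()

-- A square is 0 or 1 modulo 4, so two squares add up to a multiple of 4 only if both roots are
-- even.
halve-squares : ∀ x y w → x ℕ.* x ℕ.+ y ℕ.* y ≡ 4 ℕ.* w →
                ∃[ x′ ] ∃[ y′ ] (x ≡ 2 ℕ.* x′ × y ≡ 2 ℕ.* y′ × x′ ℕ.* x′ ℕ.+ y′ ℕ.* y′ ≡ w)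
halve-squares x y w eq with parity x | parity y
... | even a | even b = a , b , refl , refl , ℕ.*-cancelˡ-≡ (a ℕ.* a ℕ.+ b ℕ.* b) w 4 (trans (lemma a b) eq)
  where
  lemma : ∀ a b → 4 ℕ.* (a ℕ.* a ℕ.+ b ℕ.* b) ≡ (2 ℕ.* a) ℕ.* (2 ℕ.* a) ℕ.+ (2 ℕ.* b) ℕ.* (2 ℕ.* b)
  lemma = ℕ-Solver.solve-∀
... | even a | odd b = ⊥-elim (residue≢ 0 (a ℕ.* a ℕ.+ b ℕ.* b ℕ.+ b) w (s≤s (s≤s z≤n)) (trans (lemma a b) eq))
  where
  lemma : ∀ a b → 1 ℕ.+ 4 ℕ.* (a ℕ.* a ℕ.+ b ℕ.* b ℕ.+ b) ≡
                  (2 ℕ.* a) ℕ.* (2 ℕ.* a) ℕ.+ (1 ℕ.+ 2 ℕ.* b) ℕ.* (1 ℕ.+ 2 ℕ.* b)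
  lemma = ℕ-Solver.solve-∀
... | odd a | even b = ⊥-elim (residue≢ 0 (a ℕ.* a ℕ.+ a ℕ.+ b ℕ.* b) w (s≤s (s≤s z≤n)) (trans (lemma a b) eq))
  where
  lemma : ∀ a b → 1 ℕ.+ 4 ℕ.* (a ℕ.* a ℕ.+ a ℕ.+ b ℕ.* b) ≡
                  (1 ℕ.+ 2 ℕ.* a) ℕ.* (1 ℕ.+ 2 ℕ.* a) ℕ.+ (2 ℕ.* b) ℕ.* (2 ℕ.* b)
  lemma = ℕ-Solver.solve-∀
... | odd a | odd b = ⊥-elim (residue≢ 1 (a ℕ.* a ℕ.+ a ℕ.+ b ℕ.* b ℕ.+ b) w (s≤s (s≤s (s≤s z≤n))) (trans (lemma a b) eq))
  where
  lemma : ∀ a b → 2 ℕ.+ 4 ℕ.* (a ℕ.* a ℕ.+ a ℕ.+ b ℕ.* b ℕ.+ b) ≡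
                  (1 ℕ.+ 2 ℕ.* a) ℕ.* (1 ℕ.+ 2 ℕ.* a) ℕ.+ (1 ℕ.+ 2 ℕ.* b) ℕ.* (1 ℕ.+ 2 ℕ.* b)
  lemma = ℕ-Solver.solve-∀

square≤2⇒≤1 : ∀ x y {s} → s ℕ.< 4 → x ℕ.* x ℕ.+ y ≡ s → x ≡ 0 ⊎ x ≡ 1
square≤2⇒≤1 0 y s<4 eq = inj₁ refl
square≤2⇒≤1 1 y s<4 eq = inj₂ refl
square≤2⇒≤1 (suc (suc x)) y s<4 eq = ⊥-elim (ℕ.<-irrefl refl (ℕ.<-≤-trans s<4
  (ℕ.≤-trans (ℕ.*-mono-≤ {2} {suc (suc x)} {2} {suc (suc x)} (s≤s (s≤s z≤n)) (s≤s (s≤s z≤n)))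
             (ℕ.≤-trans (ℕ.m≤m+n _ y) (ℕ.≤-reflexive eq)))))

-- Descent: x and y are halved until the right-hand side is 2, which is a sum of two squares only as
-- 1 + 1. The next lemma ends at 1 = 1 + 0 = 0 + 1 instead.
sumSquares-2*4^ : ∀ k x y → x ℕ.* x ℕ.+ y ℕ.* y ≡ 2 ℕ.* (2 ℕ.^ k ℕ.* 2 ℕ.^ k) → x ≡ 2 ℕ.^ k × y ≡ 2 ℕ.^ k
sumSquares-2*4^ zero x y eq
  with square≤2⇒≤1 x (y ℕ.* y) (s≤s (s≤s (s≤s z≤n))) eq
     | square≤2⇒≤1 y (x ℕ.* x) (s≤s (s≤s (s≤s z≤n))) (trans (ℕ.+-comm (y ℕ.* y) (x ℕ.* x)) eq)
... | inj₂ refl | inj₂ refl = refl , refl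
... | inj₁ refl | inj₁ refl with () ← eq
... | inj₁ refl | inj₂ refl with () ← eq
... | inj₂ refl | inj₁ refl with () ← eq
sumSquares-2*4^ (suc k) x y eq with halve-squares x y (2 ℕ.* (2 ℕ.^ k ℕ.* 2 ℕ.^ k)) (trans eq (lemma (2 ℕ.^ k)))
  where
  lemma : ∀ b → 2 ℕ.* ((2 ℕ.* b) ℕ.* (2 ℕ.* b)) ≡ 4 ℕ.* (2 ℕ.* (b ℕ.* b))
  lemma = ℕ-Solver.solve-∀
... | x′ , y′ , refl , refl , eq′ with sumSquares-2*4^ k x′ y′ eq′
... | refl , refl = refl , refl

sumSquares-4^ : ∀ k x y → x ℕ.* x ℕ.+ y ℕ.* y ≡ 2 ℕ.^ k ℕ.* 2 ℕ.^ k →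
                (x ≡ 2 ℕ.^ k × y ≡ 0) ⊎ (x ≡ 0 × y ≡ 2 ℕ.^ k)
sumSquares-4^ zero x y eq
  with square≤2⇒≤1 x (y ℕ.* y) (s≤s (s≤s z≤n)) eq
     | square≤2⇒≤1 y (x ℕ.* x) (s≤s (s≤s z≤n)) (trans (ℕ.+-comm (y ℕ.* y) (x ℕ.* x)) eq)
... | inj₁ refl | inj₂ refl = inj₂ (refl , refl)
... | inj₂ refl | inj₁ refl = inj₁ (refl , refl)
... | inj₁ refl | inj₁ refl with () ← eq
... | inj₂ refl | inj₂ refl with () ← eq
sumSquares-4^ (suc k) x y eq with halve-squares x y (2 ℕ.^ k ℕ.* 2 ℕ.^ k) (trans eq (lemma (2 ℕ.^ k)))
  where
  lemma : ∀ b → (2 ℕ.* b) ℕ.* (2 ℕ.* b) ≡ 4 ℕ.* (b ℕ.* b)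
  lemma = ℕ-Solver.solve-∀
... | x′ , y′ , refl , refl , eq′ with sumSquares-4^ k x′ y′ eq′
... | inj₁ (refl , refl) = inj₁ (refl , refl)
... | inj₂ (refl , refl) = inj₂ (refl , refl)

∣∣≡⇒± : ∀ {k} i → ℤ.∣ i ∣ ≡ k → i ≡ + k ⊎ i ≡ ℤ.- + k
∣∣≡⇒± (+ k)      refl = inj₁ refl
∣∣≡⇒± ℤ.-[1+ k ] refl = inj₂ refl

OneOf : ∀ {a} {A : Set a} → A → A → A → A → A → Set a
OneOf v₁ v₂ v₃ v₄ z = z ≡ v₁ ⊎ z ≡ v₂ ⊎ z ≡ v₃ ⊎ z ≡ v₄

norm-2*4^ : ∀ k z → normᴳ z ≡ + (2 ℕ.* (2 ℕ.^ k ℕ.* 2 ℕ.^ k)) → let b = + (2 ℕ.^ k) in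
            OneOf (b +i b) (b +i ℤ.- b) (ℤ.- b +i b) (ℤ.- b +i ℤ.- b) z
norm-2*4^ k (x +i y) eq
  with ∣x∣≡ , ∣y∣≡ ← sumSquares-2*4^ k ℤ.∣ x ∣ ℤ.∣ y ∣ (ℤ.+-injective (trans (sym (normᴳ≡∣∣² x y)) eq))
  with ∣∣≡⇒± x ∣x∣≡ | ∣∣≡⇒± y ∣y∣≡
... | inj₁ x≡ | inj₁ y≡ = inj₁ (cong₂ _+i_ x≡ y≡)
... | inj₁ x≡ | inj₂ y≡ = inj₂ (inj₁ (cong₂ _+i_ x≡ y≡))
... | inj₂ x≡ | inj₁ y≡ = inj₂ (inj₂ (inj₁ (cong₂ _+i_ x≡ y≡)))
... | inj₂ x≡ | inj₂ y≡ = inj₂ (inj₂ (inj₂ (cong₂ _+i_ x≡ y≡)))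

norm-4^ : ∀ k z → normᴳ z ≡ + (2 ℕ.^ k ℕ.* 2 ℕ.^ k) → let b = + (2 ℕ.^ k) in
          OneOf (b +i 0ℤ) (ℤ.- b +i 0ℤ) (0ℤ +i b) (0ℤ +i ℤ.- b) z
norm-4^ k (x +i y) eq
  with sumSquares-4^ k ℤ.∣ x ∣ ℤ.∣ y ∣ (ℤ.+-injective (trans (sym (normᴳ≡∣∣² x y)) eq))
... | inj₁ (∣x∣≡ , ∣y∣≡) with ∣∣≡⇒± x ∣x∣≡
...   | inj₁ x≡ = inj₁ (cong₂ _+i_ x≡ (ℤ.∣i∣≡0⇒i≡0 ∣y∣≡))
...   | inj₂ x≡ = inj₂ (inj₁ (cong₂ _+i_ x≡ (ℤ.∣i∣≡0⇒i≡0 ∣y∣≡)))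
norm-4^ k (x +i y) eq | inj₂ (∣x∣≡ , ∣y∣≡) with ∣∣≡⇒± y ∣y∣≡
...   | inj₁ y≡ = inj₂ (inj₂ (inj₁ (cong₂ _+i_ (ℤ.∣i∣≡0⇒i≡0 ∣x∣≡) y≡)))
...   | inj₂ y≡ = inj₂ (inj₂ (inj₂ (cong₂ _+i_ (ℤ.∣i∣≡0⇒i≡0 ∣x∣≡) y≡)))

-- Multisets with four possible values

blocks : ∀ {a} {A : Set a} → A → A → A → A → ℕ → ℕ → ℕ → ℕ → List A
blocks v₁ v₂ v₃ v₄ n₁ n₂ n₃ n₄ =
  replicate n₁ v₁ ++ replicate n₂ v₂ ++ replicate n₃ v₃ ++ replicate n₄ v₄

-- The counts stay existential here; the moment equations determine them later.
four-values-↭ : ∀ {a} {A : Set a} (v₁ v₂ v₃ v₄ : A) L → (∀ {z} → z ∈ L → OneOf v₁ v₂ v₃ v₄ z) →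
                ∃[ n₁ ] ∃[ n₂ ] ∃[ n₃ ] ∃[ n₄ ] L ↭ blocks v₁ v₂ v₃ v₄ n₁ n₂ n₃ n₄
four-values-↭ v₁ v₂ v₃ v₄ []      h = 0 , 0 , 0 , 0 , ↭-refl
four-values-↭ v₁ v₂ v₃ v₄ (z ∷ L) h with four-values-↭ v₁ v₂ v₃ v₄ L (h ∘ there) | h (here refl)
... | n₁ , n₂ , n₃ , n₄ , p | inj₁ refl = suc n₁ , n₂ , n₃ , n₄ , ↭-prep z p
... | n₁ , n₂ , n₃ , n₄ , p | inj₂ (inj₁ refl) = n₁ , suc n₂ , n₃ , n₄ ,
  ↭-trans (↭-prep z p) (↭-sym (shift z (replicate n₁ v₁) _))
... | n₁ , n₂ , n₃ , n₄ , p | inj₂ (inj₂ (inj₁ refl)) = n₁ , n₂ , suc n₃ , n₄ ,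
  ↭-trans (↭-prep z p) (↭-trans (↭-sym (shift z (replicate n₁ v₁) _))
    (++⁺ˡ (replicate n₁ v₁) (↭-sym (shift z (replicate n₂ v₂) _))))
... | n₁ , n₂ , n₃ , n₄ , p | inj₂ (inj₂ (inj₂ refl)) = n₁ , n₂ , n₃ , suc n₄ ,
  ↭-trans (↭-prep z p) (↭-trans (↭-sym (shift z (replicate n₁ v₁) _))
    (++⁺ˡ (replicate n₁ v₁) (↭-trans (↭-sym (shift z (replicate n₂ v₂) _))
      (++⁺ˡ (replicate n₂ v₂) (↭-sym (shift z (replicate n₃ v₃) _))))))

length-blocks : ∀ {a} {A : Set a} (v₁ v₂ v₃ v₄ : A) n₁ n₂ n₃ n₄ →
                length (blocks v₁ v₂ v₃ v₄ n₁ n₂ n₃ n₄) ≡ n₁ ℕ.+ (n₂ ℕ.+ (n₃ ℕ.+ n₄))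
length-blocks v₁ v₂ v₃ v₄ n₁ n₂ n₃ n₄ =
  trans (length-++ (replicate n₁ v₁)) (cong₂ ℕ._+_ (length-replicate n₁)
    (trans (length-++ (replicate n₂ v₂)) (cong₂ ℕ._+_ (length-replicate n₂)
      (trans (length-++ (replicate n₃ v₃)) (cong₂ ℕ._+_ (length-replicate n₃) (length-replicate n₄))))))

_·ᴳ_ : ℕ → ℤ[i] → ℤ[i]
n ·ᴳ z = (+ n ℤ.* re z) +i (+ n ℤ.* im z)

∑ᴳ-replicate : ∀ (h : ℤ[i] → ℤ[i]) n v → ∑ᴳ[ replicate n v ] h ≡ n ·ᴳ h v
∑ᴳ-replicate h zero    v = refl
∑ᴳ-replicate h (suc n) v = trans (cong (h v +ᴳ_) (∑ᴳ-replicate h n v))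
  (cong₂ _+i_ (sym (ℤ.suc-* (+ n) (re (h v)))) (sym (ℤ.suc-* (+ n) (im (h v)))))

∑ᴳ-blocks : ∀ (h : ℤ[i] → ℤ[i]) v₁ v₂ v₃ v₄ n₁ n₂ n₃ n₄ →
            ∑ᴳ[ blocks v₁ v₂ v₃ v₄ n₁ n₂ n₃ n₄ ] h ≡ n₁ ·ᴳ h v₁ +ᴳ (n₂ ·ᴳ h v₂ +ᴳ (n₃ ·ᴳ h v₃ +ᴳ n₄ ·ᴳ h v₄))
∑ᴳ-blocks h v₁ v₂ v₃ v₄ n₁ n₂ n₃ n₄ =
  trans (∑ᴳ.∑-++ h (replicate n₁ v₁) _) (cong₂ _+ᴳ_ (∑ᴳ-replicate h n₁ v₁)
    (trans (∑ᴳ.∑-++ h (replicate n₂ v₂) _) (cong₂ _+ᴳ_ (∑ᴳ-replicate h n₂ v₂)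
      (trans (∑ᴳ.∑-++ h (replicate n₃ v₃) _) (cong₂ _+ᴳ_ (∑ᴳ-replicate h n₃ v₃) (∑ᴳ-replicate h n₄ v₄))))))

-- The frequencies

-- κ is 2 or 4 and κb² = q = m + 1, so κb³ + κb² - b - 1 = (b + 1)(κb² - 1) = (b + 1) m.
frequency₊ : ∀ κ b m → suc m ≡ κ ℕ.* b ℕ.^ 2 → κ ℕ.* b ℕ.^ 3 ℕ.+ κ ℕ.* b ℕ.^ 2 ∸ b ∸ 1 ≡ (b ℕ.+ 1) ℕ.* m
frequency₊ κ b m eq = begin
  κ ℕ.* b ℕ.^ 3 ℕ.+ κ ℕ.* b ℕ.^ 2 ∸ b ∸ 1  ≡⟨ ℕ.∸-+-assoc _ b 1 ⟩
  κ ℕ.* b ℕ.^ 3 ℕ.+ κ ℕ.* b ℕ.^ 2 ∸ (b ℕ.+ 1) ≡⟨ cong (_∸ (b ℕ.+ 1)) total ⟩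
  (b ℕ.+ 1) ℕ.* m ℕ.+ (b ℕ.+ 1) ∸ (b ℕ.+ 1)  ≡⟨ ℕ.m+n∸n≡m ((b ℕ.+ 1) ℕ.* m) (b ℕ.+ 1) ⟩
  (b ℕ.+ 1) ℕ.* m                            ∎
  where
  open ≡-Reasoning
  factor : ∀ κ b → κ ℕ.* (b ℕ.* (b ℕ.* (b ℕ.* 1))) ℕ.+ κ ℕ.* (b ℕ.* (b ℕ.* 1)) ≡ (b ℕ.+ 1) ℕ.* (κ ℕ.* (b ℕ.* (b ℕ.* 1)))
  factor = ℕ-Solver.solve-∀
  total : κ ℕ.* b ℕ.^ 3 ℕ.+ κ ℕ.* b ℕ.^ 2 ≡ (b ℕ.+ 1) ℕ.* m ℕ.+ (b ℕ.+ 1)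
  total = trans (factor κ b) (trans (cong ((b ℕ.+ 1) ℕ.*_) (sym eq))
            (trans (ℕ.*-suc (b ℕ.+ 1) m) (ℕ.+-comm (b ℕ.+ 1) _)))

-- Here κb³ + 1 - κb² - b = (b - 1)(κb² - 1), and writing b = c + 1 makes b - 1 the natural number
-- c.
frequency₋ : ∀ κ c m → suc m ≡ κ ℕ.* suc c ℕ.^ 2 →
             κ ℕ.* suc c ℕ.^ 3 ℕ.+ 1 ∸ κ ℕ.* suc c ℕ.^ 2 ∸ suc c ≡ c ℕ.* m
frequency₋ κ c m eq = begin
  κ ℕ.* b ℕ.^ 3 ℕ.+ 1 ∸ κ ℕ.* b ℕ.^ 2 ∸ b     ≡⟨ ℕ.∸-+-assoc _ (κ ℕ.* b ℕ.^ 2) b ⟩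
  κ ℕ.* b ℕ.^ 3 ℕ.+ 1 ∸ (κ ℕ.* b ℕ.^ 2 ℕ.+ b) ≡⟨ cong₂ (λ s t → s ℕ.+ 1 ∸ (t ℕ.+ b)) (trans (factor κ b) (cong (b ℕ.*_) (sym eq))) (sym eq) ⟩
  b ℕ.* suc m ℕ.+ 1 ∸ (suc m ℕ.+ b)           ≡⟨ cong (_∸ (suc m ℕ.+ b)) (total c m) ⟩
  c ℕ.* m ℕ.+ (suc m ℕ.+ b) ∸ (suc m ℕ.+ b)   ≡⟨ ℕ.m+n∸n≡m (c ℕ.* m) (suc m ℕ.+ b) ⟩
  c ℕ.* m                                     ∎
  where
  open ≡-Reasoning
  b = suc c
  factor : ∀ κ b → κ ℕ.* (b ℕ.* (b ℕ.* (b ℕ.* 1))) ≡ b ℕ.* (κ ℕ.* (b ℕ.* (b ℕ.* 1)))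
  factor = ℕ-Solver.solve-∀
  total : ∀ c m → (1 ℕ.+ c) ℕ.* (1 ℕ.+ m) ℕ.+ 1 ≡ c ℕ.* m ℕ.+ ((1 ℕ.+ m) ℕ.+ (1 ℕ.+ c))
  total = ℕ-Solver.solve-∀

pos-length : ∀ n₁ n₂ n₃ n₄ → + (n₁ ℕ.+ (n₂ ℕ.+ (n₃ ℕ.+ n₄))) ≡ + n₁ ℤ.+ (+ n₂ ℤ.+ (+ n₃ ℤ.+ + n₄))
pos-length n₁ n₂ n₃ n₄ = trans (ℤ.pos-+ n₁ (n₂ ℕ.+ (n₃ ℕ.+ n₄)))
  (cong (ℤ._+_ (+ n₁)) (trans (ℤ.pos-+ n₂ (n₃ ℕ.+ n₄)) (cong (ℤ._+_ (+ n₂)) (ℤ.pos-+ n₃ n₄))))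

pos-product : ∀ x y z → + (x ℕ.* (y ℕ.* z)) ≡ + x ℤ.* (+ y ℤ.* + z)
pos-product x y z = trans (ℤ.pos-* x (y ℕ.* z)) (cong (ℤ._*_ (+ x)) (ℤ.pos-* y z))

-- The number of elements and the first two moments determine the four frequencies.

module OddFrequencies (B M Q N₁ N₂ N₃ N₄ : ℤ) where
  open import Data.Integer.Base using (_+_; _*_; _-_; -_; 1ℤ; -1ℤ)

  -- `S₁` and `S₂` are the real and imaginary part of the first moment, `S₃` the imaginary part of
  -- the second; its real part is trivial, as the squares of ±b ± bi are imaginary. The sums stay
  -- unsimplified to agree by computation with components of `ℤ[i]` expressions.
  S₀ S₁ S₂ S₃ : ℤ
  S₀ = N₁ + (N₂ + (N₃ + N₄))
  S₁ = Q + (N₁ * B + (N₂ * B + (N₃ * - B + N₄ * - B)))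
  S₂ = 0ℤ + (N₁ * B + (N₂ * - B + (N₃ * B + N₄ * - B)))
  S₃ = (Q * 0ℤ + 0ℤ * Q) + (N₁ * (B * B + B * B) + (N₂ * (B * - B + - B * B) +
       (N₃ * (- B * B + B * - B) + N₄ * (- B * - B + - B * - B))))

  module _ .{{_ : ℤ.NonZero B}} (Q≡1+M : Q ≡ 1ℤ + M) (Q≡2B² : Q ≡ + 2 * (B * B))
           (e₀ : S₀ ≡ M * Q) (e₁ : S₁ ≡ Q * Q) (e₂ : S₂ ≡ 0ℤ) (e₃ : S₃ ≡ 0ℤ) where

    -- The signs σ₁, σ₂, σ₃ select a row of the inverse of the coefficient matrix.
    combination : ∀ σ₁ σ₂ σ₃ → + 2 * (B * B) * S₀ + σ₁ * (+ 2 * B * (S₁ - Q)) + σ₂ * (+ 2 * B * S₂) + σ₃ * S₃ ≡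
                  + 4 * (B * B) * (B * ((B + σ₁) * M))
    combination σ₁ σ₂ σ₃ = begin
      + 2 * (B * B) * S₀ + σ₁ * (+ 2 * B * (S₁ - Q)) + σ₂ * (+ 2 * B * S₂) + σ₃ * S₃
        ≡⟨ cong₂ _+_ (cong₂ _+_ (cong₂ _+_ (cong (+ 2 * (B * B) *_) e₀) (cong (λ s → σ₁ * (+ 2 * B * (s - Q))) e₁))
             (cong (λ s → σ₂ * (+ 2 * B * s)) e₂)) (cong (σ₃ *_) e₃) ⟩
      + 2 * (B * B) * (M * Q) + σ₁ * (+ 2 * B * (Q * Q - Q)) + σ₂ * (+ 2 * B * 0ℤ) + σ₃ * 0ℤ
        ≡⟨ cong (λ s → + 2 * (B * B) * (M * Q) + σ₁ * (+ 2 * B * s) + σ₂ * (+ 2 * B * 0ℤ) + σ₃ * 0ℤ)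
             (trans (cong (λ s → s * Q - Q) Q≡1+M) (step M Q)) ⟩
      + 2 * (B * B) * (M * Q) + σ₁ * (+ 2 * B * (M * Q)) + σ₂ * (+ 2 * B * 0ℤ) + σ₃ * 0ℤ
        ≡⟨ cong (λ s → + 2 * (B * B) * (M * s) + σ₁ * (+ 2 * B * (M * s)) + σ₂ * (+ 2 * B * 0ℤ) + σ₃ * 0ℤ) Q≡2B² ⟩
      + 2 * (B * B) * (M * (+ 2 * (B * B))) + σ₁ * (+ 2 * B * (M * (+ 2 * (B * B)))) + σ₂ * (+ 2 * B * 0ℤ) + σ₃ * 0ℤ
        ≡⟨ final B M σ₁ σ₂ σ₃ ⟩
      + 4 * (B * B) * (B * ((B + σ₁) * M)) ∎
      where
      open ≡-Reasoning
      step : ∀ M Q → (1ℤ + M) * Q - Q ≡ M * Q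
      step = ℤ-Solver.solve-∀
      final : ∀ B M σ₁ σ₂ σ₃ → + 2 * (B * B) * (M * (+ 2 * (B * B))) + σ₁ * (+ 2 * B * (M * (+ 2 * (B * B)))) + σ₂ * (+ 2 * B * 0ℤ) + σ₃ * 0ℤ ≡
              + 4 * (B * B) * (B * ((B + σ₁) * M))
      final = ℤ-Solver.solve-∀

    private
      cancel : ∀ {x y} → + 4 * (B * B) * x ≡ + 4 * (B * B) * y → x ≡ y
      cancel {x} {y} = ℤ.*-cancelˡ-≡ (+ 4 * (B * B)) x y {{ℤ.i*j≢0 (+ 4) (B * B) {{_}} {{ℤ.i*j≢0 B B}}}}

    -- Over the four values, the sign vectors of 1, Re, Im and Re · Im are orthogonal, so a signed
    -- sum of the equations isolates one frequency. The signs σ₁, σ₂, σ₃ are those of Re, Im and Re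
    -- · Im at the value counted.
    frequency₁ : N₁ * + 2 ≡ B * ((B + 1ℤ) * M)
    frequency₁ = cancel (trans (identity B Q N₁ N₂ N₃ N₄) (combination 1ℤ 1ℤ 1ℤ))
      where
      identity : ∀ B Q N₁ N₂ N₃ N₄ → + 4 * (B * B) * (N₁ * + 2) ≡
        + 2 * (B * B) * (N₁ + (N₂ + (N₃ + N₄)))
        + 1ℤ * (+ 2 * B * (Q + (N₁ * B + (N₂ * B + (N₃ * - B + N₄ * - B))) - Q))
        + 1ℤ * (+ 2 * B * (0ℤ + (N₁ * B + (N₂ * - B + (N₃ * B + N₄ * - B)))))
        + 1ℤ * ((Q * 0ℤ + 0ℤ * Q) + (N₁ * (B * B + B * B) + (N₂ * (B * - B + - B * B) +
                (N₃ * (- B * B + B * - B) + N₄ * (- B * - B + - B * - B)))))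
      identity = ℤ-Solver.solve-∀

    frequency₂ : N₂ * + 2 ≡ B * ((B + 1ℤ) * M)
    frequency₂ = cancel (trans (identity B Q N₁ N₂ N₃ N₄) (combination 1ℤ -1ℤ -1ℤ))
      where
      identity : ∀ B Q N₁ N₂ N₃ N₄ → + 4 * (B * B) * (N₂ * + 2) ≡
        + 2 * (B * B) * (N₁ + (N₂ + (N₃ + N₄)))
        + 1ℤ * (+ 2 * B * (Q + (N₁ * B + (N₂ * B + (N₃ * - B + N₄ * - B))) - Q))
        + -1ℤ * (+ 2 * B * (0ℤ + (N₁ * B + (N₂ * - B + (N₃ * B + N₄ * - B)))))
        + -1ℤ * ((Q * 0ℤ + 0ℤ * Q) + (N₁ * (B * B + B * B) + (N₂ * (B * - B + - B * B) +
                (N₃ * (- B * B + B * - B) + N₄ * (- B * - B + - B * - B)))))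
      identity = ℤ-Solver.solve-∀

    frequency₃ : N₃ * + 2 ≡ B * ((B + -1ℤ) * M)
    frequency₃ = cancel (trans (identity B Q N₁ N₂ N₃ N₄) (combination -1ℤ 1ℤ -1ℤ))
      where
      identity : ∀ B Q N₁ N₂ N₃ N₄ → + 4 * (B * B) * (N₃ * + 2) ≡
        + 2 * (B * B) * (N₁ + (N₂ + (N₃ + N₄)))
        + -1ℤ * (+ 2 * B * (Q + (N₁ * B + (N₂ * B + (N₃ * - B + N₄ * - B))) - Q))
        + 1ℤ * (+ 2 * B * (0ℤ + (N₁ * B + (N₂ * - B + (N₃ * B + N₄ * - B)))))
        + -1ℤ * ((Q * 0ℤ + 0ℤ * Q) + (N₁ * (B * B + B * B) + (N₂ * (B * - B + - B * B) +
                (N₃ * (- B * B + B * - B) + N₄ * (- B * - B + - B * - B)))))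
      identity = ℤ-Solver.solve-∀

    frequency₄ : N₄ * + 2 ≡ B * ((B + -1ℤ) * M)
    frequency₄ = cancel (trans (identity B Q N₁ N₂ N₃ N₄) (combination -1ℤ -1ℤ 1ℤ))
      where
      identity : ∀ B Q N₁ N₂ N₃ N₄ → + 4 * (B * B) * (N₄ * + 2) ≡
        + 2 * (B * B) * (N₁ + (N₂ + (N₃ + N₄)))
        + -1ℤ * (+ 2 * B * (Q + (N₁ * B + (N₂ * B + (N₃ * - B + N₄ * - B))) - Q))
        + -1ℤ * (+ 2 * B * (0ℤ + (N₁ * B + (N₂ * - B + (N₃ * B + N₄ * - B)))))
        + 1ℤ * ((Q * 0ℤ + 0ℤ * Q) + (N₁ * (B * B + B * B) + (N₂ * (B * - B + - B * B) +
                (N₃ * (- B * B + B * - B) + N₄ * (- B * - B + - B * - B)))))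
      identity = ℤ-Solver.solve-∀

module EvenFrequencies (B M Q N₁ N₂ N₃ N₄ : ℤ) where
  open import Data.Integer.Base using (_+_; _*_; _-_; -_; 1ℤ; -1ℤ)

  -- `D` is √q, the absolute value at the units. The squares of ±D and ±Di are real, so `S₃` is now
  -- the real part of the second moment.
  D S₀ S₁ S₂ S₃ : ℤ
  D  = + 2 * B
  S₀ = N₁ + (N₂ + (N₃ + N₄))
  S₁ = Q + (N₁ * D + (N₂ * - D + (N₃ * 0ℤ + N₄ * 0ℤ)))
  S₂ = 0ℤ + (N₁ * 0ℤ + (N₂ * 0ℤ + (N₃ * D + N₄ * - D)))
  S₃ = (Q * Q - 0ℤ * 0ℤ) + (N₁ * (D * D - 0ℤ * 0ℤ) + (N₂ * (- D * - D - 0ℤ * 0ℤ) +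
       (N₃ * (0ℤ * 0ℤ - D * D) + N₄ * (0ℤ * 0ℤ - - D * - D))))

  module _ .{{_ : ℤ.NonZero B}} (Q≡1+M : Q ≡ 1ℤ + M) (Q≡4B² : Q ≡ + 4 * (B * B))
           (e₀ : S₀ ≡ M * Q) (e₁ : S₁ ≡ Q * Q) (e₂ : S₂ ≡ 0ℤ) (e₃ : S₃ ≡ Q * Q) where

    combination : ∀ σ₁ σ₂ σ₃ → D * D * S₀ + σ₁ * (+ 2 * D * (S₁ - Q)) + σ₂ * (+ 2 * D * S₂) + σ₃ * (S₃ - Q * Q) ≡
                  + 4 * (D * D) * (B * ((B + σ₁) * M))
    combination σ₁ σ₂ σ₃ = begin
      D * D * S₀ + σ₁ * (+ 2 * D * (S₁ - Q)) + σ₂ * (+ 2 * D * S₂) + σ₃ * (S₃ - Q * Q)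
        ≡⟨ cong₂ _+_ (cong₂ _+_ (cong₂ _+_ (cong (D * D *_) e₀) (cong (λ s → σ₁ * (+ 2 * D * (s - Q))) e₁))
             (cong (λ s → σ₂ * (+ 2 * D * s)) e₂)) (cong (λ s → σ₃ * (s - Q * Q)) e₃) ⟩
      D * D * (M * Q) + σ₁ * (+ 2 * D * (Q * Q - Q)) + σ₂ * (+ 2 * D * 0ℤ) + σ₃ * (Q * Q - Q * Q)
        ≡⟨ cong₂ (λ s t → D * D * (M * Q) + σ₁ * (+ 2 * D * s) + σ₂ * (+ 2 * D * 0ℤ) + σ₃ * t)
             (trans (cong (λ s → s * Q - Q) Q≡1+M) (step M Q)) (ℤ.i≡j⇒i-j≡0 {Q * Q} refl) ⟩
      D * D * (M * Q) + σ₁ * (+ 2 * D * (M * Q)) + σ₂ * (+ 2 * D * 0ℤ) + σ₃ * 0ℤ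
        ≡⟨ cong (λ s → D * D * (M * s) + σ₁ * (+ 2 * D * (M * s)) + σ₂ * (+ 2 * D * 0ℤ) + σ₃ * 0ℤ) Q≡4B² ⟩
      D * D * (M * (+ 4 * (B * B))) + σ₁ * (+ 2 * D * (M * (+ 4 * (B * B)))) + σ₂ * (+ 2 * D * 0ℤ) + σ₃ * 0ℤ
        ≡⟨ final B M σ₁ σ₂ σ₃ ⟩
      + 4 * (D * D) * (B * ((B + σ₁) * M)) ∎
      where
      open ≡-Reasoning
      step : ∀ M Q → (1ℤ + M) * Q - Q ≡ M * Q
      step = ℤ-Solver.solve-∀
      final : ∀ B M σ₁ σ₂ σ₃ → + 2 * B * (+ 2 * B) * (M * (+ 4 * (B * B))) + σ₁ * (+ 2 * (+ 2 * B) * (M * (+ 4 * (B * B)))) +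
              σ₂ * (+ 2 * (+ 2 * B) * 0ℤ) + σ₃ * 0ℤ ≡
              + 4 * (+ 2 * B * (+ 2 * B)) * (B * ((B + σ₁) * M))
      final = ℤ-Solver.solve-∀

    private
      cancel : ∀ {x y} → + 4 * (D * D) * x ≡ + 4 * (D * D) * y → x ≡ y
      cancel {x} {y} = ℤ.*-cancelˡ-≡ (+ 4 * (D * D)) x y {{ℤ.i*j≢0 (+ 4) (D * D) {{_}} {{ℤ.i*j≢0 D D {{ℤ.i*j≢0 (+ 2) B}} {{ℤ.i*j≢0 (+ 2) B}}}}}}

    -- In units of `D` the values are 1, -1, i, -i, and σ₁, σ₂, σ₃ are the real part, the imaginary
    -- part and the square of the value counted.
    frequency₁ : N₁ ≡ B * ((B + 1ℤ) * M)
    frequency₁ = cancel (trans (identity D Q N₁ N₂ N₃ N₄) (combination 1ℤ 0ℤ 1ℤ))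
      where
      identity : ∀ D Q N₁ N₂ N₃ N₄ → + 4 * (D * D) * N₁ ≡
        D * D * (N₁ + (N₂ + (N₃ + N₄))) + 1ℤ * (+ 2 * D * (Q + (N₁ * D + (N₂ * - D + (N₃ * 0ℤ + N₄ * 0ℤ))) - Q))
        + 0ℤ * (+ 2 * D * (0ℤ + (N₁ * 0ℤ + (N₂ * 0ℤ + (N₃ * D + N₄ * - D)))))
        + 1ℤ * ((Q * Q - 0ℤ * 0ℤ) + (N₁ * (D * D - 0ℤ * 0ℤ) + (N₂ * (- D * - D - 0ℤ * 0ℤ) +
       (N₃ * (0ℤ * 0ℤ - D * D) + N₄ * (0ℤ * 0ℤ - - D * - D)))) - Q * Q)
      identity = ℤ-Solver.solve-∀

    frequency₂ : N₂ ≡ B * ((B + -1ℤ) * M)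
    frequency₂ = cancel (trans (identity D Q N₁ N₂ N₃ N₄) (combination -1ℤ 0ℤ 1ℤ))
      where
      identity : ∀ D Q N₁ N₂ N₃ N₄ → + 4 * (D * D) * N₂ ≡
        D * D * (N₁ + (N₂ + (N₃ + N₄))) + -1ℤ * (+ 2 * D * (Q + (N₁ * D + (N₂ * - D + (N₃ * 0ℤ + N₄ * 0ℤ))) - Q))
        + 0ℤ * (+ 2 * D * (0ℤ + (N₁ * 0ℤ + (N₂ * 0ℤ + (N₃ * D + N₄ * - D)))))
        + 1ℤ * ((Q * Q - 0ℤ * 0ℤ) + (N₁ * (D * D - 0ℤ * 0ℤ) + (N₂ * (- D * - D - 0ℤ * 0ℤ) +
       (N₃ * (0ℤ * 0ℤ - D * D) + N₄ * (0ℤ * 0ℤ - - D * - D)))) - Q * Q)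
      identity = ℤ-Solver.solve-∀

    frequency₃ : N₃ ≡ B * ((B + 0ℤ) * M)
    frequency₃ = cancel (trans (identity D Q N₁ N₂ N₃ N₄) (combination 0ℤ 1ℤ -1ℤ))
      where
      identity : ∀ D Q N₁ N₂ N₃ N₄ → + 4 * (D * D) * N₃ ≡
        D * D * (N₁ + (N₂ + (N₃ + N₄))) + 0ℤ * (+ 2 * D * (Q + (N₁ * D + (N₂ * - D + (N₃ * 0ℤ + N₄ * 0ℤ))) - Q))
        + 1ℤ * (+ 2 * D * (0ℤ + (N₁ * 0ℤ + (N₂ * 0ℤ + (N₃ * D + N₄ * - D)))))
        + -1ℤ * ((Q * Q - 0ℤ * 0ℤ) + (N₁ * (D * D - 0ℤ * 0ℤ) + (N₂ * (- D * - D - 0ℤ * 0ℤ) +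
       (N₃ * (0ℤ * 0ℤ - D * D) + N₄ * (0ℤ * 0ℤ - - D * - D)))) - Q * Q)
      identity = ℤ-Solver.solve-∀

    frequency₄ : N₄ ≡ B * ((B + 0ℤ) * M)
    frequency₄ = cancel (trans (identity D Q N₁ N₂ N₃ N₄) (combination 0ℤ -1ℤ -1ℤ))
      where
      identity : ∀ D Q N₁ N₂ N₃ N₄ → + 4 * (D * D) * N₄ ≡
        D * D * (N₁ + (N₂ + (N₃ + N₄))) + 0ℤ * (+ 2 * D * (Q + (N₁ * D + (N₂ * - D + (N₃ * 0ℤ + N₄ * 0ℤ))) - Q))
        + -1ℤ * (+ 2 * D * (0ℤ + (N₁ * 0ℤ + (N₂ * 0ℤ + (N₃ * D + N₄ * - D)))))
        + -1ℤ * ((Q * Q - 0ℤ * 0ℤ) + (N₁ * (D * D - 0ℤ * 0ℤ) + (N₂ * (- D * - D - 0ℤ * 0ℤ) +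
       (N₃ * (0ℤ * 0ℤ - D * D) + N₄ * (0ℤ * 0ℤ - - D * - D)))) - Q * Q)
      identity = ℤ-Solver.solve-∀

blocks-cong : ∀ {a} {A : Set a} {v₁ v₂ v₃ v₄ : A} {n₁ n₂ n₃ n₄ k₁ k₂ k₃ k₄} →
              n₁ ≡ k₁ → n₂ ≡ k₂ → n₃ ≡ k₃ → n₄ ≡ k₄ →
              blocks v₁ v₂ v₃ v₄ n₁ n₂ n₃ n₄ ≡ blocks v₁ v₂ v₃ v₄ k₁ k₂ k₃ k₄
blocks-cong refl refl refl refl = refl

square : ℤ[i] → ℤ[i]
square z = z *ᴳ z

module Multiset (c m : ℕ) where
  b q : ℕ
  b = suc c
  q = suc m

  module _ (M : List ℤ[i]) (length-M : length M ≡ m ℕ.* q)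
           (moment₁ : (+ q +i 0ℤ) +ᴳ ∑ᴳ[ M ] id ≡ + (q ℕ.* q) +i 0ℤ)
           (moment₂ : square (+ q +i 0ℤ) +ᴳ ∑ᴳ[ M ] square ≡ + (q ℕ.* q) +i 0ℤ) where

    module Block (v₁ v₂ v₃ v₄ : ℤ[i]) (n₁ n₂ n₃ n₄ : ℕ) (p : M ↭ blocks v₁ v₂ v₃ v₄ n₁ n₂ n₃ n₄) where

      count : + n₁ ℤ.+ (+ n₂ ℤ.+ (+ n₃ ℤ.+ + n₄)) ≡ + m ℤ.* + q
      count = trans (sym (pos-length n₁ n₂ n₃ n₄)) (trans (cong +_ (trans (sym (length-blocks v₁ v₂ v₃ v₄ n₁ n₂ n₃ n₄))
        (trans (sym (↭-length p)) length-M))) (ℤ.pos-* m q))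

      block-moment : ∀ h {w} → h (+ q +i 0ℤ) +ᴳ ∑ᴳ[ M ] h ≡ w →
        h (+ q +i 0ℤ) +ᴳ (n₁ ·ᴳ h v₁ +ᴳ (n₂ ·ᴳ h v₂ +ᴳ (n₃ ·ᴳ h v₃ +ᴳ n₄ ·ᴳ h v₄))) ≡ w
      block-moment h eq = trans (cong (h (+ q +i 0ℤ) +ᴳ_)
        (sym (trans (∑ᴳ.∑-↭ h p) (∑ᴳ-blocks h v₁ v₂ v₃ v₄ n₁ n₂ n₃ n₄)))) eq

    oddSpectrum-↭ : q ≡ 2 ℕ.* b ℕ.^ 2 →
      (∀ {z} → z ∈ M → OneOf (+ b +i + b) (+ b +i ℤ.- + b) (ℤ.- + b +i + b) (ℤ.- + b +i ℤ.- + b) z) →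
      (+ q +i 0ℤ) ∷ replicate m 0ᴳ ++ M ↭ oddSpectrum b
    oddSpectrum-↭ q≡ values = arrange (four-values-↭ _ _ _ _ M values)
      where
      half : ∀ n k → + n ℤ.* + 2 ≡ + b ℤ.* (+ k ℤ.* + m) → n ≡ (b ℕ.* (k ℕ.* m)) ℕ./ 2
      half n k eq = trans (sym (ℕ.m*n/n≡m n 2)) (cong (ℕ._/ 2)
        (ℤ.+-injective (trans (ℤ.pos-* n 2) (trans eq (sym (pos-product b k m))))))
      arrange : ∃[ n₁ ] ∃[ n₂ ] ∃[ n₃ ] ∃[ n₄ ] M ↭ blocks _ _ _ _ n₁ n₂ n₃ n₄ →
                (+ q +i 0ℤ) ∷ replicate m 0ᴳ ++ M ↭ oddSpectrum b
      arrange (n₁ , n₂ , n₃ , n₄ , p) = ↭-trans (↭-prep _ (++⁺ˡ (replicate m 0ᴳ) p)) (↭-reflexive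
          (cong₂ _∷_ (cong (λ k → + k +i 0ℤ) q≡) (cong₂ _++_ (cong (λ k → replicate (k ∸ 1) 0ᴳ) q≡) (blocks-cong
            (trans (half n₁ (b ℕ.+ 1) (F.frequency₁ refl Q≡ e₀ e₁ e₂ e₃)) plus)
            (trans (half n₂ (b ℕ.+ 1) (F.frequency₂ refl Q≡ e₀ e₁ e₂ e₃)) plus)
            (trans (half n₃ c (F.frequency₃ refl Q≡ e₀ e₁ e₂ e₃)) minus)
            (trans (half n₄ c (F.frequency₄ refl Q≡ e₀ e₁ e₂ e₃)) minus)))))
        where
        module K = Block (+ b +i + b) (+ b +i ℤ.- + b) (ℤ.- + b +i + b) (ℤ.- + b +i ℤ.- + b)
                         n₁ n₂ n₃ n₄ p
        module F = OddFrequencies (+ b) (+ m) (+ q) (+ n₁) (+ n₂) (+ n₃) (+ n₄)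
        Q≡ : + q ≡ + 2 ℤ.* (+ b ℤ.* + b)
        Q≡ = trans (cong +_ (trans q≡ (cong (λ k → 2 ℕ.* (b ℕ.* k)) (ℕ.*-identityʳ b)))) (pos-product 2 b b)
        e₀ : F.S₀ ≡ + m ℤ.* + q
        e₀ = K.count
        e₁ : F.S₁ ≡ + q ℤ.* + q
        e₁ = trans (cong re (K.block-moment id moment₁)) (ℤ.pos-* q q)
        e₂ : F.S₂ ≡ 0ℤ
        e₂ = cong im (K.block-moment id moment₁)
        e₃ : F.S₃ ≡ 0ℤ
        e₃ = cong im (K.block-moment square moment₂)
        plus = cong (λ k → b ℕ.* k ℕ./ 2) (sym (frequency₊ 2 b m q≡))
        minus = cong (λ k → b ℕ.* k ℕ./ 2) (sym (frequency₋ 2 c m q≡))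

    evenSpectrum-↭ : q ≡ 4 ℕ.* b ℕ.^ 2 →
      (∀ {z} → z ∈ M → OneOf (+ (2 ℕ.* b) +i 0ℤ) (ℤ.- + (2 ℕ.* b) +i 0ℤ) (0ℤ +i + (2 ℕ.* b)) (0ℤ +i ℤ.- + (2 ℕ.* b)) z) →
      (+ q +i 0ℤ) ∷ replicate m 0ᴳ ++ M ↭ evenSpectrum b
    evenSpectrum-↭ q≡ values = arrange (four-values-↭ _ _ _ _ M values)
      where
      natural : ∀ n k → + n ≡ + b ℤ.* (+ k ℤ.* + m) → n ≡ b ℕ.* (k ℕ.* m)
      natural n k eq = ℤ.+-injective (trans eq (sym (pos-product b k m)))
      arrange : ∃[ n₁ ] ∃[ n₂ ] ∃[ n₃ ] ∃[ n₄ ] M ↭ blocks _ _ _ _ n₁ n₂ n₃ n₄ →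
                (+ q +i 0ℤ) ∷ replicate m 0ᴳ ++ M ↭ evenSpectrum b
      arrange (n₁ , n₂ , n₃ , n₄ , p) = ↭-trans (↭-prep _ (++⁺ˡ (replicate m 0ᴳ) p)) (↭-reflexive
          (cong₂ _∷_ (cong (λ k → + k +i 0ℤ) q≡) (cong₂ _++_ (cong (λ k → replicate (k ∸ 1) 0ᴳ) q≡) (blocks-cong
            (trans (natural n₁ (b ℕ.+ 1) (F.frequency₁ refl Q≡ e₀ e₁ e₂ e₃)) (cong (b ℕ.*_) (sym (frequency₊ 4 b m q≡))))
            (trans (natural n₂ c (F.frequency₂ refl Q≡ e₀ e₁ e₂ e₃)) (cong (b ℕ.*_) (sym (frequency₋ 4 c m q≡))))
            (trans (natural n₃ b (trans (F.frequency₃ refl Q≡ e₀ e₁ e₂ e₃) b+0)) imaginary)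
            (trans (natural n₄ b (trans (F.frequency₄ refl Q≡ e₀ e₁ e₂ e₃) b+0)) imaginary)))))
        where
        module K = Block (+ (2 ℕ.* b) +i 0ℤ) (ℤ.- + (2 ℕ.* b) +i 0ℤ) (0ℤ +i + (2 ℕ.* b)) (0ℤ +i ℤ.- + (2 ℕ.* b))
                         n₁ n₂ n₃ n₄ p
        module F = EvenFrequencies (+ b) (+ m) (+ q) (+ n₁) (+ n₂) (+ n₃) (+ n₄)
        Q≡ : + q ≡ + 4 ℤ.* (+ b ℤ.* + b)
        Q≡ = trans (cong +_ (trans q≡ (cong (λ k → 4 ℕ.* (b ℕ.* k)) (ℕ.*-identityʳ b)))) (pos-product 4 b b)
        e₀ : F.S₀ ≡ + m ℤ.* + q
        e₀ = K.count
        e₁ : F.S₁ ≡ + q ℤ.* + q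
        e₁ = trans (cong re (K.block-moment id moment₁)) (ℤ.pos-* q q)
        e₂ : F.S₂ ≡ 0ℤ
        e₂ = cong im (K.block-moment id moment₁)
        e₃ : F.S₃ ≡ + q ℤ.* + q
        e₃ = trans (cong re (K.block-moment square moment₂)) (ℤ.pos-* q q)
        b+0 : + b ℤ.* ((+ b ℤ.+ 0ℤ) ℤ.* + m) ≡ + b ℤ.* (+ b ℤ.* + m)
        b+0 = cong (λ k → + b ℤ.* (k ℤ.* + m)) (ℤ.+-identityʳ (+ b))
        imaginary : b ℕ.* (b ℕ.* m) ≡ b ℕ.^ 2 ℕ.* (4 ℕ.* b ℕ.^ 2 ∸ 1)
        imaginary = trans (sym (ℕ.*-assoc b b m)) (cong₂ ℕ._*_ (cong (b ℕ.*_) (sym (ℕ.*-identityʳ b))) (cong (_∸ 1) q≡))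

-- The two parities of n

double-half : ∀ k → (2 ℕ.* k) ℕ./ 2 ≡ k
double-half k = trans (cong (ℕ._/ 2) (ℕ.*-comm 2 k)) (ℕ.m*n/n≡m k 2)

double-mod : ∀ k → (2 ℕ.* k) ℕ.% 2 ≡ 0
double-mod k = trans (cong (ℕ._% 2) (ℕ.*-comm 2 k)) (ℕ.m*n%n≡0 k 2)

1+double-mod : ∀ k → (1 ℕ.+ 2 ℕ.* k) ℕ.% 2 ≡ 1
1+double-mod k = trans (cong (λ t → (1 ℕ.+ t) ℕ.% 2) (ℕ.*-comm 2 k)) (ℕ.[m+kn]%n≡m%n 1 k 2)

2^-double : ∀ k → 2 ℕ.^ (2 ℕ.* k) ≡ (2 ℕ.^ k) ℕ.^ 2
2^-double k = trans (cong (2 ℕ.^_) (ℕ.*-comm 2 k)) (sym (ℕ.^-*-assoc 2 k 2))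

^2≡* : ∀ b → b ℕ.^ 2 ≡ b ℕ.* b
^2≡* b = cong (b ℕ.*_) (ℕ.*-identityʳ b)

-- The parity of n′ is opposite to that of n = n′ + 1. For n′ = 2k one has q = 2b², for n′ = 2k + 1
-- one has q = 4b², with b = 2^k in both cases.
spectrum-↭ : ∀ n′ {m q} (M : List ℤ[i]) → suc m ≡ q → q ≡ 2 ℕ.^ suc n′ → length M ≡ m ℕ.* q →
             (+ q +i 0ℤ) +ᴳ ∑ᴳ[ M ] id ≡ + (q ℕ.* q) +i 0ℤ →
             square (+ q +i 0ℤ) +ᴳ ∑ᴳ[ M ] square ≡ + (q ℕ.* q) +i 0ℤ →
             (∀ {z} → z ∈ M → normᴳ z ≡ + q) →
             (suc n′ ℕ.% 2 ≡ 1 → (+ q +i 0ℤ) ∷ replicate m 0ᴳ ++ M ↭ oddSpectrum (2 ℕ.^ ((suc n′ ∸ 1) ℕ./ 2))) ×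
             (suc n′ ℕ.% 2 ≡ 0 → (+ q +i 0ℤ) ∷ replicate m 0ᴳ ++ M ↭ evenSpectrum (2 ℕ.^ ((suc n′ ∸ 2) ℕ./ 2)))
spectrum-↭ n′ {m} {q} M refl q≡ len mom₁ mom₂ norm with parity n′
... | even k = odd-case , λ eq → ⊥-elim (ℕ.0≢1+n (trans (sym eq) (1+double-mod k)))
  where
  q≡2*b² : q ≡ 2 ℕ.* (2 ℕ.^ k) ℕ.^ 2
  q≡2*b² = trans q≡ (cong (2 ℕ.*_) (2^-double k))
  arrange : ∀ b → .{{NonZero b}} → q ≡ 2 ℕ.* b ℕ.^ 2 →
            (∀ {z} → z ∈ M → OneOf (+ b +i + b) (+ b +i ℤ.- + b) (ℤ.- + b +i + b) (ℤ.- + b +i ℤ.- + b) z) →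
            (+ q +i 0ℤ) ∷ replicate m 0ᴳ ++ M ↭ oddSpectrum b
  arrange (suc c) = Multiset.oddSpectrum-↭ c m M len mom₁ mom₂
  odd-case : suc (2 ℕ.* k) ℕ.% 2 ≡ 1 → (+ q +i 0ℤ) ∷ replicate m 0ᴳ ++ M ↭ oddSpectrum (2 ℕ.^ ((2 ℕ.* k) ℕ./ 2))
  odd-case _ = subst (λ l → (+ q +i 0ℤ) ∷ replicate m 0ᴳ ++ M ↭ oddSpectrum (2 ℕ.^ l)) (sym (double-half k))
    (arrange (2 ℕ.^ k) {{ℕ.m^n≢0 2 k}} q≡2*b² λ {z} z∈ →
      norm-2*4^ k z (trans (norm z∈) (cong +_ (trans q≡2*b² (cong (2 ℕ.*_) (^2≡* (2 ℕ.^ k)))))))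
... | odd k = (λ eq → ⊥-elim (ℕ.0≢1+n (trans (sym (2+double-mod k)) eq))) , even-case
  where
  2+double-mod : ∀ k → (2 ℕ.+ 2 ℕ.* k) ℕ.% 2 ≡ 0
  2+double-mod k = trans (cong (ℕ._% 2) (sym (ℕ.*-suc 2 k))) (double-mod (suc k))
  q≡4*b² : q ≡ 4 ℕ.* (2 ℕ.^ k) ℕ.^ 2
  q≡4*b² = trans q≡ (trans (sym (ℕ.*-assoc 2 2 (2 ℕ.^ (2 ℕ.* k)))) (cong (4 ℕ.*_) (2^-double k)))
  4*b²≡ : ∀ b → 4 ℕ.* (b ℕ.* (b ℕ.* 1)) ≡ (2 ℕ.* b) ℕ.* (2 ℕ.* b)
  4*b²≡ = ℕ-Solver.solve-∀
  arrange : ∀ b → .{{NonZero b}} → q ≡ 4 ℕ.* b ℕ.^ 2 →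
            (∀ {z} → z ∈ M → OneOf (+ (2 ℕ.* b) +i 0ℤ) (ℤ.- + (2 ℕ.* b) +i 0ℤ) (0ℤ +i + (2 ℕ.* b)) (0ℤ +i ℤ.- + (2 ℕ.* b)) z) →
            (+ q +i 0ℤ) ∷ replicate m 0ᴳ ++ M ↭ evenSpectrum b
  arrange (suc c) = Multiset.evenSpectrum-↭ c m M len mom₁ mom₂
  even-case : suc (1 ℕ.+ 2 ℕ.* k) ℕ.% 2 ≡ 0 → (+ q +i 0ℤ) ∷ replicate m 0ᴳ ++ M ↭ evenSpectrum (2 ℕ.^ ((2 ℕ.* k) ℕ./ 2))
  even-case _ = subst (λ l → (+ q +i 0ℤ) ∷ replicate m 0ᴳ ++ M ↭ evenSpectrum (2 ℕ.^ l)) (sym (double-half k))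
    (arrange (2 ℕ.^ k) {{ℕ.m^n≢0 2 k}} q≡4*b² λ {z} z∈ →
      -- The absolute value is 2b = 2^(k+1), hence `suc k`.
      norm-4^ (suc k) z (trans (norm z∈) (cong +_ (trans q≡4*b² (4*b²≡ (2 ℕ.^ k))))))

-- A ring with 4^0 = 1 element has 2 = 0. This disposes of n = 0; everything else is set up for n =
-- n′ + 1.
no-GaloisRing₄-0 : ∀ {c : Level} → GaloisRing₄ c 0 → ⊥
no-GaloisRing₄-0 G = 2≢0 (trans (sym (from-to 2#)) (trans (cong (Inverse.from enumeration)
    (only (Inverse.to enumeration 2#) (Inverse.to enumeration 0#))) (from-to 0#)))
  where
  open GaloisRing₄ G
  only : ∀ (i j : Fin 1) → i ≡ j
  only Fin.zero Fin.zero = refl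

open import Data.Nat.Base using (_^_; _/_; _%_)

corollary4p6 : ∀ {c : Level} (n : ℕ) (G : GaloisRing₄ c n) (ξ : GaloisRing₄.Carrier G) →
    GaloisRing₄.HasOrder G ξ (2 ^ n ∸ 1) →
    (f : GaloisRing₄.Carrier G → GaloisRing₄.Carrier G) →
    Teichmüller.PseudoPlanar G ξ f →
    f (GaloisRing₄.0# G) ≡ GaloisRing₄.0# G →
    (n % 2 ≡ 1 → Teichmüller.fourierSpectrum G ξ f ↭ oddSpectrum (2 ^ ((n ∸ 1) / 2)))
    × (n % 2 ≡ 0 → Teichmüller.fourierSpectrum G ξ f ↭ evenSpectrum (2 ^ ((n ∸ 2) / 2)))
corollary4p6 zero     G ξ ξ-order f f-pseudoPlanar f-0 = ⊥-elim (no-GaloisRing₄-0 G)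
corollary4p6 (suc n′) G ξ ξ-order f f-pseudoPlanar f-0 =
  map× (λ spectrum n-odd → ↭-trans E.fourierSpectrum-↭ (spectrum n-odd))
       (λ spectrum n-even → ↭-trans E.fourierSpectrum-↭ (spectrum n-even))
    (spectrum-↭ n′ E.regular R.suc-m refl E.length-regular
      (trans (E.moment id refl) E.∑X) (trans (E.moment square refl) E.∑X²) E.norm-regular)
  where
  module R = Galois n′ G ξ ξ-order
  module E = Galois.Spectrum n′ G ξ ξ-order f f-pseudoPlanar f-0
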